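{- Let $q\ge 1$ and $n\ge 5$. For $k=1,\dots,q$ define $\varphi_k:A_n^q\to A_n^q$ by $(\sigma_1,\dots,\sigma_{k-1},\sigma_k,\sigma_{k+1},\dots,\sigma_q)^{\varphi_k}=(\sigma_1,\dots,\sigma_{k-1},\sigma_k^{ -1},\sigma_{k+1},\dots,\sigma_q)$. Then $$\mathrm{Aut}(A\Gamma_n^q)=(R(A_n^q)\rtimes(\mathrm{Inn}(S_n)\wr S_q))\rtimes Z_2^q,$$ where $\mathrm{Inn}(S_n)\cong S_n$ is the inner automorphism group of $S_n$, $Z_2^q=\langle\varphi_1\rangle\times\langle\varphi_2\rangle\times\cdots\times\langle\varphi_q\rangle$, and $\mathrm{Inn}(S_n)\wr S_q$ is the wreath product.
   Context: Let $X=\{1,\dots,n\}$; permutations act on the right, $i^\sigma$ denoting the image of $i$ under $\sigma$. $S_n$ is the symmetric group and $A_n$ the alternating group on $X$. Let $\mathcal{E}_n=\{\sigma\in A_n: i^\sigma\neq i \text{ for all } i\in X\}$. The even derangement graph $A\Gamma_n$ is the Cayley graph $\Gamma(A_n,\mathcal{E}_n)$: vertex set $A_n$, edges $\{g,sg\}$ for $g\in A_n$, $s\in\mathcal{E}_n$. $A\Gamma_n^q$ is the tensor product of $q$ copies of $A\Gamma_n$, i.e. the Cayley graph $\Gamma(A_n^q,\mathcal{E}_n^q)$: vertex set $A_n^q$ (direct product), with $(\sigma_1,\dots,\sigma_q)$ adjacent to $(\tau_1,\dots,\tau_q)$ iff $i^{\sigma_k}\neq i^{\tau_k}$ for all $i\in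 X$ and all $k$. All groups are regarded as permutation groups on the vertex set $A_n^q$: $R(A_n^q)$ is the right regular representation ($x\mapsto xg$, $g\in A_n^q$); $\mathrm{Inn}(S_n)\wr S_q$ acts as group automorphisms of $A_n^q$, with the $k$-th copy of $\mathrm{Inn}(S_n)$ conjugating the $k$-th coordinate by an element of $S_n$ and $S_q$ permuting coordinates.
   Formalization: The outer "⋊ Z_2^q" is read as a product with unique factorisation; normality of R(A_n^q)⋊(Inn(S_n)≀S_q) in Aut is not claimed, since it fails for q ≥ 2 (conjugating a coordinate swap by φ_1 gives (x_1,x_2) ↦ (x_2^{ -1},x_1^{ -1})); for q=1 it follows from index 2. -}

module Defs where

open import Data.Nat using (ℕ; zero; suc)
open import Data.Nat.Divisibility using (_∣_)
open import Data.Bool using (Bool; true; false; if_then_else_; _∧_)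
open import Data.Fin using (Fin; zero; suc; toℕ)
import Data.Nat as N
open import Data.Fin.Properties using (_≟_)
open import Data.Vec using (Vec; []; _∷_; lookup; tabulate; allFin)
import Data.List as L
open import Data.Maybe using (Maybe; just; nothing; fromMaybe)
import Data.Maybe as M
open import Data.Product using (Σ; _×_; _,_; ∃)
open import Relation.Nullary using (¬_; yes; no)
open import Relation.Binary.PropositionalEquality using (_≡_; _≢_)

-- A (candidate) permutation of X = Fin n is stored as its image vector:
-- i^σ = lookup σ i.
PermV : ℕ → Set
PermV n = Vec (Fin n) n

IsPerm : ∀ {n} → PermV n → Set
IsPerm {n} σ = ∀ (i j : Fin n) → lookup σ i ≡ lookup σ j → i ≡ j

_·_ : ∀ {n} → PermV n → PermV n → PermV n
σ · τ = tabulate λ i → lookup τ (lookup σ i)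

findPos : ∀ {n m} → Fin n → Vec (Fin n) m → Maybe (Fin m)
findPos j [] = nothing
findPos j (x ∷ xs) with x ≟ j
... | yes _ = just zero
... | no _ = M.map suc (findPos j xs)

-- inverse permutation (for a genuine permutation σ, j^(σ⁻¹) is the unique i with i^σ = j)
inv : ∀ {n} → PermV n → PermV n
inv σ = tabulate λ j → fromMaybe j (findPos j σ)

_<ᶠ_ : ∀ {n} → Fin n → Fin n → Bool
i <ᶠ j = toℕ i N.<ᵇ toℕ j

inversions : ∀ {n} → PermV n → ℕ
inversions {n} σ =
  L.length (L.filterᵇ (λ p → (Data.Product.proj₁ p <ᶠ Data.Product.proj₂ p)
                            ∧ (lookup σ (Data.Product.proj₂ p) <ᶠ lookup σ (Data.Product.proj₁ p)))
                      (L.cartesianProduct (L.allFin n) (L.allFin n)))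

InA : ∀ {n} → PermV n → Set
InA σ = IsPerm σ × (2 ∣ inversions σ)

V : ℕ → ℕ → Set
V n q = Vec (PermV n) q

IsVertex : ∀ {n q} → V n q → Set
IsVertex {n} {q} x = ∀ (k : Fin q) → InA (lookup x k)

Adj : ∀ {n q} → V n q → V n q → Set
Adj {n} {q} x y = ∀ (k : Fin q) (i : Fin n) → lookup (lookup x k) i ≢ lookup (lookup y k) i

-- graph automorphism of AΓ_n^q, given by a map f on the ambient type V n q
-- (only its restriction to the vertex set A_n^q matters)
IsAut : ∀ {n q} → (V n q → V n q) → Set
IsAut {n} {q} f =
  (∀ x → IsVertex x → IsVertex (f x)) ×
  (∀ x y → IsVertex x → IsVertex y → f x ≡ f y → x ≡ y) ×
  (∀ y → IsVertex y → Σ (V n q) λ x → IsVertex x × f x ≡ y) ×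
  (∀ x y → IsVertex x → IsVertex y → (Adj x y → Adj (f x) (f y)) × (Adj (f x) (f y) → Adj x y))

Rmul : ∀ {n q} → V n q → V n q → V n q
Rmul {q = q} g x = tabulate λ k → lookup x k · lookup g k

conj : ∀ {n} → PermV n → PermV n → PermV n
conj c σ = (inv c · σ) · c

-- element (c₁,…,c_q ; π) of Inn(S_n) ≀ S_q acting on A_n^q:
-- the k-th output coordinate is the conjugate by c_k of the (k^π)-th input coordinate
Wact : ∀ {n q} → Vec (PermV n) q → PermV q → V n q → V n q
Wact c π x = tabulate λ k → conj (lookup c k) (lookup x (lookup π k))

-- φ_ε = ∏_{k : ε_k = true} φ_k ∈ Z_2^q: invert the coordinates where ε is true
Phi : ∀ {n q} → Vec Bool q → V n q → V n q
Phi ε x = tabulate λ k → if lookup ε k then inv (lookup x k) else lookup x k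

-- the element R(g) · (c;π) · φ_ε of (R(A_n^q) ⋊ (Inn(S_n) ≀ S_q)) ⋊ Z_2^q,
-- acting on the right: x ↦ ((x g)^(c;π))^φ_ε
Elt : ∀ {n q} → V n q → Vec (PermV n) q → PermV q → Vec Bool q → V n q → V n q
Elt g c π ε x = Phi ε (Wact c π (Rmul g x))

ValidParams : ∀ {n q} → V n q → Vec (PermV n) q → PermV q → Set
ValidParams {n} {q} g c π = IsVertex g × (∀ (k : Fin q) → IsPerm (lookup c k)) × IsPerm π

_≗ᵥ_ : ∀ {n q} → (V n q → V n q) → (V n q → V n q) → Set
f ≗ᵥ h = ∀ x → IsVertex x → f x ≡ h x

{-# OPTIONS --safe #-}
module Submission where

open import Defs
open import Data.Nat using (ℕ; zero; suc; _≤_; z≤n; s≤s)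
import Data.Nat as ℕ
import Data.Nat.Properties as ℕP
open import Data.Nat.Divisibility using (_∣_; divides)
open import Data.Parity.Base using (Parity; 0ℙ; 1ℙ) renaming (_+_ to _⊕_)
import Data.Parity.Properties as ℙP
open import Data.Bool using (Bool; true; false; _∧_; _∨_; not; if_then_else_)
open import Data.Fin using (Fin; zero; suc; toℕ; punchOut; punchIn)
open import Data.Fin.Patterns using (0F; 1F; 2F; 3F; 4F; 5F)
open import Data.Fin.Properties using (_≟_; any?; all?; toℕ-injective; punchOut-injective; punchIn-injective; punchInᵢ≢i; punchIn-punchOut; <⇒notInjective; suc-injective)
open import Data.Fin.Permutation using (Permutation; permutation)
open import Data.Fin.Permutation.Components using (transpose; transpose-inverse)
import Data.Vec as Vec
open import Data.Vec using (Vec; []; _∷_; tabulate; replicate; _[_]≔_) renaming (lookup to infixl 30 _!_)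
open import Data.Vec.Properties using (lookup∘tabulate; tabulate∘lookup; tabulate-cong; lookup-replicate; lookup-map; ≡-dec; lookup∘update; lookup∘update′)
import Data.List as L
import Data.List.Properties as LP
open import Data.List.Relation.Unary.All using (All; []; _∷_; lookupAny) renaming (all? to allList?; map to All-map; zip to All-zip; head to All-head; tail to All-tail)
open import Data.List.Relation.Unary.Any using (Any; here; there; satisfied) renaming (any? to anyList?)
open import Data.Nat.DivMod using (_mod_)
open import Data.List.Relation.Unary.All.Properties using (tabulate⁺; tabulate⁻)
open import Data.Maybe using (just; fromMaybe)
import Data.Product.Properties as Product
open import Data.Product using (Σ; _×_; _,_; proj₁; proj₂; ∃; ∃₂)
open import Data.Sum using (_⊎_; inj₁; inj₂; [_,_]′) renaming (swap to swap⊎)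
open import Data.List.Membership.Propositional using (_∈_)
open import Data.List.Membership.Propositional.Properties using (∈-allFin)
open import Data.Empty using (⊥; ⊥-elim)
open import Data.Unit using (tt)
open import Function using (_∘_; id)
open import Relation.Nullary using (¬_; Dec; yes; no; does)
open import Relation.Nullary.Decidable using (¬?; _×-dec_; _→-dec_; _⊎-dec_; map′; toWitness; decidable-stable; dec-true; dec-false)
open import Relation.Binary.PropositionalEquality
open import Algebra.Properties.CommutativeMonoid.Sum ℕP.+-0-commutativeMonoid using (sum; ∑-comm; ∑-distrib-+; sum-permute; sum-cong-≗)

open ≡-Reasoning

-- Write A_p = {x : x_k(i) = j} for a cell p = (k , i , j); two vertices are non-adjacent iff they share such a set.
-- The key point is that an automorphism f permutes the sets A_p.  The image H of A_p is independent, and any two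
-- vertices outside H have a common neighbour in H, because two permutations missing a cell are avoided by an even
-- permutation through it.  These two properties first force H to depend on a single coordinate.  If H contained no
-- A_p' and n ≥ 6, then every set of at most three cells of an h ∈ H would lie in a vertex outside H; H would therefore
-- be closed under multiplication by 3-cycles (otherwise h is covered by two vertices outside H), hence contain two
-- adjacent vertices.  For n = 5 one uses instead that H meets all the cosets of a 5-cycle, which are maximal cliques.
-- Finally the induced bijection of cells preserves disjointness of the sets A_p, so it is an automorphism of q disjoint
-- n × n rook's graphs: it permutes the coordinates and, in each of them, rows and columns, possibly transposed.

-- Parity is the recurring obstacle: every avoider must be even, so the constructions carry a
-- prescribed sign. Size 4 is too small to start an induction: there the identity and a 3-cycle are
-- avoided simultaneously by odd permutations only. Hence the base case is a finite search at n = 5.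
-- The 3-cycle argument needs a vertex outside H that agrees with h at three points. For n = 5 the
-- only even permutation agreeing with h at three points is h itself, so that size is treated by
-- another search. For an image of a star only one inclusion is proved: it contains some A_p'. The
-- inclusions for f and for its inverse compose to an inclusion between two stars, which forces
-- equality of the cells, and this makes every inclusion in between an equality. On the group side
-- an element is also encoded by its map of cells. Both halves of the theorem then compare cell
-- maps: an automorphism is matched with the element inducing its cell map, and the parameters of an
-- element are read off from that map.

private variable
  m n q : ℕ
  A B : Set

-- Permutations as image vectors.

vec-ext : {xs ys : Vec A n} → (∀ i → xs ! i ≡ ys ! i) → xs ≡ ys
vec-ext {xs = xs} {ys} h = begin
  xs                 ≡⟨ tabulate∘lookup xs ⟨
  tabulate (xs !_)   ≡⟨ tabulate-cong h ⟩
  tabulate (ys !_)   ≡⟨ tabulate∘lookup ys ⟩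
  ys                 ∎

injective⇒surjective : (f : Fin n → Fin n) → (∀ i j → f i ≡ f j → i ≡ j) → ∀ j → ∃ λ i → f i ≡ j
injective⇒surjective {suc n} f f-inj j with any? (λ i → f i ≟ j)
... | yes p = p
... | no ¬p = ⊥-elim (<⇒notInjective (ℕP.n<1+n n) g-inj)
  where
  j≢f : ∀ i → j ≢ f i
  j≢f i eq = ¬p (i , sym eq)
  g : Fin (suc n) → Fin n
  g i = punchOut (j≢f i)
  g-inj : ∀ {i k} → g i ≡ g k → i ≡ k
  g-inj {i} {k} eq = f-inj i k (punchOut-injective (j≢f i) (j≢f k) eq)

-- IsPerm unfolds to a function type, from which σ cannot be inferred.
record Perm (σ : PermV n) : Set where
  constructor perm
  field injective : IsPerm σ
open Perm

lookup-· : (σ τ : PermV n) (i : Fin n) → (σ · τ) ! i ≡ τ ! (σ ! i)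
lookup-· σ τ i = lookup∘tabulate _ i

Perm-· : {σ τ : PermV n} → Perm σ → Perm τ → Perm (σ · τ)
Perm-· {σ = σ} {τ} pσ pτ .injective i j eq =
  pσ .injective i j (pτ .injective _ _ (trans (sym (lookup-· σ τ i)) (trans eq (lookup-· σ τ j))))

ι : PermV n
ι = tabulate id

lookup-ι : (i : Fin n) → ι ! i ≡ i
lookup-ι i = lookup∘tabulate id i

Perm-ι : Perm (ι {n})
Perm-ι .injective i j eq = trans (sym (lookup-ι i)) (trans eq (lookup-ι j))

findPos-complete : (xs : Vec (Fin n) m) (j : Fin n) (i : Fin m) → xs ! i ≡ j → ∃ λ k → findPos j xs ≡ just k × xs ! k ≡ j
findPos-complete (x ∷ xs) j i eq with x ≟ j
... | yes x≡j = zero , refl , x≡j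
findPos-complete (x ∷ xs) j zero eq | no x≢j = ⊥-elim (x≢j eq)
findPos-complete (x ∷ xs) j (suc i) eq | no x≢j with findPos-complete xs j i eq
... | k , found , hit rewrite found = suc k , refl , hit

lookup-inv-· : {σ : PermV n} → Perm σ → ∀ j → σ ! (inv σ ! j) ≡ j
lookup-inv-· {σ = σ} pσ j with injective⇒surjective (σ !_) (pσ .injective) j
... | i , eq with findPos-complete σ j i eq
... | k , found , hit = begin
  σ ! (inv σ ! j)                      ≡⟨ cong (σ !_) (lookup∘tabulate _ j) ⟩
  σ ! fromMaybe j (findPos j σ)        ≡⟨ cong (λ p → σ ! fromMaybe j p) found ⟩
  σ ! k                                ≡⟨ hit ⟩
  j                                    ∎

lookup-·-inv : {σ : PermV n} → Perm σ → ∀ i → inv σ ! (σ ! i) ≡ i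
lookup-·-inv {σ = σ} pσ i = pσ .injective _ _ (lookup-inv-· pσ (σ ! i))

Perm-inv : {σ : PermV n} → Perm σ → Perm (inv σ)
Perm-inv {σ = σ} pσ .injective i j eq =
  trans (sym (lookup-inv-· pσ i)) (trans (cong (σ !_) eq) (lookup-inv-· pσ j))

inv-·ˡ : {σ : PermV n} → Perm σ → inv σ · σ ≡ ι
inv-·ˡ {σ = σ} pσ = vec-ext λ i →
  trans (lookup-· (inv σ) σ i) (trans (lookup-inv-· pσ i) (sym (lookup-ι i)))

toPermutation : {σ : PermV n} → Perm σ → Permutation n n
toPermutation {σ = σ} pσ = permutation (σ !_) (inv σ !_)
  (lookup-inv-· pσ) (lookup-·-inv pσ)

-- Inversion counts and the sign homomorphism.

𝟙 : Bool → ℕ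
𝟙 true  = 1
𝟙 false = 0

Σ₂ : (Fin n → Fin n → ℕ) → ℕ
Σ₂ f = sum λ i → sum (f i)

inverted : PermV n → Fin n → Fin n → Bool
inverted σ i j = (i <ᶠ j) ∧ (σ ! j <ᶠ σ ! i)

length-filterᵇ-++ : (p : A → Bool) (xs ys : L.List A) →
  L.length (L.filterᵇ p (xs L.++ ys)) ≡ L.length (L.filterᵇ p xs) ℕ.+ L.length (L.filterᵇ p ys)
length-filterᵇ-++ p L.[] ys = refl
length-filterᵇ-++ p (x L.∷ xs) ys with p x
... | true  = cong suc (length-filterᵇ-++ p xs ys)
... | false = length-filterᵇ-++ p xs ys

length-filterᵇ-tabulate : (p : A → Bool) (f : Fin m → A) →
  L.length (L.filterᵇ p (L.tabulate f)) ≡ sum λ i → 𝟙 (p (f i))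
length-filterᵇ-tabulate {m = zero}  p f = refl
length-filterᵇ-tabulate {m = suc m} p f with p (f zero)
... | true  = cong suc (length-filterᵇ-tabulate p (f ∘ suc))
... | false = length-filterᵇ-tabulate p (f ∘ suc)

length-filterᵇ-cartesianProduct : (p : A × B → Bool) (f : Fin m → A) (g : Fin n → B) →
  L.length (L.filterᵇ p (L.cartesianProduct (L.tabulate f) (L.tabulate g))) ≡ sum λ i → sum λ j → 𝟙 (p (f i , g j))
length-filterᵇ-cartesianProduct {m = zero}  p f g = refl
length-filterᵇ-cartesianProduct {m = suc m} p f g =
  trans (length-filterᵇ-++ p (L.map (f zero ,_) (L.tabulate g)) _)
    (cong₂ ℕ._+_
      (trans (cong (L.length ∘ L.filterᵇ p) (LP.map-tabulate g (f zero ,_)))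
             (length-filterᵇ-tabulate p (λ j → f zero , g j)))
      (length-filterᵇ-cartesianProduct p (f ∘ suc) g))

inversions≡Σ₂ : (σ : PermV n) → inversions σ ≡ Σ₂ λ i j → 𝟙 (inverted σ i j)
inversions≡Σ₂ σ = length-filterᵇ-cartesianProduct (λ (i , j) → inverted σ i j) id id

Σ₂-cong : {f g : Fin n → Fin n → ℕ} → (∀ i j → f i j ≡ g i j) → Σ₂ f ≡ Σ₂ g
Σ₂-cong eq = sum-cong-≗ λ i → sum-cong-≗ (eq i)

Σ₂-distrib : (f g : Fin n → Fin n → ℕ) → Σ₂ (λ i j → f i j ℕ.+ g i j) ≡ Σ₂ f ℕ.+ Σ₂ g
Σ₂-distrib f g = trans (sum-cong-≗ λ i → ∑-distrib-+ (f i) (g i)) (∑-distrib-+ (sum ∘ f) (sum ∘ g))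

Σ₂-permute : {σ : PermV n} → Perm σ → (f : Fin n → Fin n → ℕ) → Σ₂ (λ i j → f (σ ! i) (σ ! j)) ≡ Σ₂ f
Σ₂-permute {σ = σ} pσ f = sym (trans (sum-permute (sum ∘ f) π) (sum-cong-≗ λ i → sum-permute (f (σ ! i)) π))
  where π = toPermutation pσ

+-cancel-double : ∀ {a b} → a ℕ.+ a ≡ b ℕ.+ b → a ≡ b
+-cancel-double {zero}  {zero}  eq = refl
+-cancel-double {suc a} {suc b} eq =
  cong suc (+-cancel-double (ℕP.suc-injective (ℕP.suc-injective
    (trans (cong suc (sym (ℕP.+-suc a a))) (trans eq (cong suc (ℕP.+-suc b b)))))))

<ᵇ-irrefl : ∀ k → (k ℕ.<ᵇ k) ≡ false
<ᵇ-irrefl zero    = refl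
<ᵇ-irrefl (suc k) = <ᵇ-irrefl k

<ᵇ-flip : ∀ k l → k ≢ l → (l ℕ.<ᵇ k) ≡ not (k ℕ.<ᵇ l)
<ᵇ-flip zero    zero    k≢l = ⊥-elim (k≢l refl)
<ᵇ-flip zero    (suc l) k≢l = refl
<ᵇ-flip (suc k) zero    k≢l = refl
<ᵇ-flip (suc k) (suc l) k≢l = <ᵇ-flip k l (k≢l ∘ cong suc)

<ᶠ-flip : {i j : Fin n} → i ≢ j → (j <ᶠ i) ≡ not (i <ᶠ j)
<ᶠ-flip {i = i} {j} i≢j = <ᵇ-flip (toℕ i) (toℕ j) (i≢j ∘ toℕ-injective)

-- Halving the sum over ordered pairs shows that the sum over i < j of a symmetric quantity can be reindexed.
module _ (g : Fin n → Fin n → Bool) (g-sym : ∀ i j → g i j ≡ g j i) (g-irrefl : ∀ i → g i i ≡ false) where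

  half : Σ₂ (λ i j → 𝟙 ((i <ᶠ j) ∧ g i j)) ℕ.+ Σ₂ (λ i j → 𝟙 ((i <ᶠ j) ∧ g i j)) ≡ Σ₂ λ i j → 𝟙 (g i j)
  half = begin
    Σ₂ up ℕ.+ Σ₂ up                     ≡⟨ cong (Σ₂ up ℕ.+_) (∑-comm up) ⟩
    Σ₂ up ℕ.+ Σ₂ (λ i j → up j i)       ≡⟨ cong (Σ₂ up ℕ.+_) (Σ₂-cong λ i j → cong (λ b → 𝟙 ((j <ᶠ i) ∧ b)) (g-sym j i)) ⟩
    Σ₂ up ℕ.+ Σ₂ down                   ≡⟨ Σ₂-distrib up down ⟨
    Σ₂ (λ i j → up i j ℕ.+ down i j)    ≡⟨ Σ₂-cong pointwise ⟩
    Σ₂ (λ i j → 𝟙 (g i j))              ∎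
    where
    up down : Fin n → Fin n → ℕ
    up   i j = 𝟙 ((i <ᶠ j) ∧ g i j)
    down i j = 𝟙 ((j <ᶠ i) ∧ g i j)
    pointwise : ∀ i j → 𝟙 ((i <ᶠ j) ∧ g i j) ℕ.+ 𝟙 ((j <ᶠ i) ∧ g i j) ≡ 𝟙 (g i j)
    pointwise i j with i ≟ j
    ... | yes refl rewrite g-irrefl i with i <ᶠ i
    ...   | true  = refl
    ...   | false = refl
    pointwise i j | no i≢j rewrite <ᶠ-flip i≢j with i <ᶠ j | g i j
    ... | true  | true  = refl
    ... | true  | false = refl
    ... | false | true  = refl
    ... | false | false = refl

-- The unordered pair {a, b} is an inversion of `τ`. The symmetric form allows evaluation at two
-- images under `σ`, whose order is not known.
discordant : PermV n → Fin n → Fin n → Bool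
discordant τ a b = ((a <ᶠ b) ∧ (τ ! b <ᶠ τ ! a)) ∨ ((b <ᶠ a) ∧ (τ ! a <ᶠ τ ! b))

discordant-sym : (τ : PermV n) → ∀ a b → discordant τ a b ≡ discordant τ b a
discordant-sym τ a b with a <ᶠ b | b <ᶠ a | τ ! a <ᶠ τ ! b | τ ! b <ᶠ τ ! a
... | true  | true  | true  | true  = refl
... | true  | true  | true  | false = refl
... | true  | true  | false | true  = refl
... | true  | true  | false | false = refl
... | true  | false | _     | true  = refl
... | true  | false | _     | false = refl
... | false | true  | true  | _     = refl
... | false | true  | false | _     = refl
... | false | false | _     | _     = refl

discordant-irrefl : (τ : PermV n) → ∀ a → discordant τ a a ≡ false
discordant-irrefl τ a rewrite <ᵇ-irrefl (toℕ a) = refl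

-- `σ` permutes unordered pairs, but not the pairs i < j. Both sides are therefore doubled to sums
-- over ordered pairs, which `σ` does permute, and the factor 2 is cancelled.
inversions-reindex : {σ : PermV n} (τ : PermV n) → Perm σ →
  Σ₂ (λ i j → 𝟙 ((i <ᶠ j) ∧ discordant τ (σ ! i) (σ ! j))) ≡ inversions τ
inversions-reindex {σ = σ} τ pσ = trans
  (+-cancel-double (trans (half (λ i j → discordant τ (σ ! i) (σ ! j))
                             (λ i j → discordant-sym τ (σ ! i) (σ ! j)) (λ i → discordant-irrefl τ (σ ! i)))
                   (trans (Σ₂-permute pσ (λ i j → 𝟙 (discordant τ i j)))
                   (sym (half (discordant τ) (discordant-sym τ) (discordant-irrefl τ))))))
  (trans (Σ₂-cong pointwise) (sym (inversions≡Σ₂ τ)))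
  where
  pointwise : ∀ i j → 𝟙 ((i <ᶠ j) ∧ discordant τ i j) ≡ 𝟙 (inverted τ i j)
  pointwise i j with i ≟ j
  ... | yes refl rewrite <ᵇ-irrefl (toℕ i) = refl
  ... | no i≢j rewrite <ᶠ-flip i≢j with i <ᶠ j | τ ! j <ᶠ τ ! i
  ...   | true  | true  = refl
  ...   | true  | false = refl
  ...   | false | _     = refl

parity : ℕ → Parity
parity = ℕ.parity

⊕-interchange : ∀ a b c d → (a ⊕ b) ⊕ (c ⊕ d) ≡ (a ⊕ c) ⊕ (b ⊕ d)
⊕-interchange 0ℙ 0ℙ c  d  = refl
⊕-interchange 0ℙ 1ℙ 0ℙ 0ℙ = refl
⊕-interchange 0ℙ 1ℙ 0ℙ 1ℙ = refl
⊕-interchange 0ℙ 1ℙ 1ℙ 0ℙ = refl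
⊕-interchange 0ℙ 1ℙ 1ℙ 1ℙ = refl
⊕-interchange 1ℙ 0ℙ 0ℙ 0ℙ = refl
⊕-interchange 1ℙ 0ℙ 0ℙ 1ℙ = refl
⊕-interchange 1ℙ 0ℙ 1ℙ 0ℙ = refl
⊕-interchange 1ℙ 0ℙ 1ℙ 1ℙ = refl
⊕-interchange 1ℙ 1ℙ 0ℙ 0ℙ = refl
⊕-interchange 1ℙ 1ℙ 0ℙ 1ℙ = refl
⊕-interchange 1ℙ 1ℙ 1ℙ 0ℙ = refl
⊕-interchange 1ℙ 1ℙ 1ℙ 1ℙ = refl

parity-sum : (f g h : Fin n → ℕ) → (∀ i → parity (f i) ≡ parity (g i) ⊕ parity (h i)) →
  parity (sum f) ≡ parity (sum g) ⊕ parity (sum h)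
parity-sum {zero}  f g h eq = refl
parity-sum {suc n} f g h eq = begin
  parity (f zero ℕ.+ sum (f ∘ suc))
    ≡⟨ ℙP.+-homo-+ (f zero) _ ⟩
  parity (f zero) ⊕ parity (sum (f ∘ suc))
    ≡⟨ cong₂ _⊕_ (eq zero) (parity-sum (f ∘ suc) (g ∘ suc) (h ∘ suc) (eq ∘ suc)) ⟩
  (parity (g zero) ⊕ parity (h zero)) ⊕ (parity (sum (g ∘ suc)) ⊕ parity (sum (h ∘ suc)))
    ≡⟨ ⊕-interchange (parity (g zero)) _ _ _ ⟩
  (parity (g zero) ⊕ parity (sum (g ∘ suc))) ⊕ (parity (h zero) ⊕ parity (sum (h ∘ suc)))
    ≡⟨ cong₂ _⊕_ (ℙP.+-homo-+ (g zero) _) (ℙP.+-homo-+ (h zero) _) ⟨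
  parity (sum g) ⊕ parity (sum h) ∎

even⇒2∣ : ∀ k → parity k ≡ 0ℙ → 2 ∣ k
even⇒2∣ zero          eq = divides 0 refl
even⇒2∣ (suc (suc k)) eq with even⇒2∣ k eq
... | divides c refl = divides (suc c) refl

2∣⇒even : ∀ {k} → 2 ∣ k → parity k ≡ 0ℙ
2∣⇒even (divides zero    refl) = refl
2∣⇒even (divides (suc c) refl) = 2∣⇒even (divides c refl)

opaque
  -- Opaque, so that goals keep the form `sgn σ`; the count is unfolded only in proofs about
  -- inversions and in closed computations.
  sgn : PermV n → Parity
  sgn σ = parity (inversions σ)

opaque
  unfolding sgn

  -- The order of a pair is reversed by the product exactly when one of the two factors reverses it,
  -- `τ` being judged at the images under `σ`. Summing this modulo 2 over all pairs gives the claim.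
  sgn-· : {σ τ : PermV n} → Perm σ → Perm τ → sgn (σ · τ) ≡ sgn σ ⊕ sgn τ
  sgn-· {σ = σ} {τ} pσ pτ = begin
    parity (inversions (σ · τ))
      ≡⟨ cong parity (inversions≡Σ₂ (σ · τ)) ⟩
    parity (Σ₂ λ i j → 𝟙 (inverted (σ · τ) i j))
      ≡⟨ parity-sum _ _ _ (λ i → parity-sum _ _ _ (pointwise i)) ⟩
    parity (Σ₂ λ i j → 𝟙 (inverted σ i j)) ⊕ parity (Σ₂ λ i j → 𝟙 ((i <ᶠ j) ∧ discordant τ (σ ! i) (σ ! j)))
      ≡⟨ cong₂ (λ k l → parity k ⊕ parity l) (sym (inversions≡Σ₂ σ)) (inversions-reindex τ pσ) ⟩
    sgn σ ⊕ sgn τ ∎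
    where
    -- `P` is i < j, `S` says that `σ` keeps the order of i and j, `T` that the product reverses it;
    -- `τ` reverses the image pair iff `S` and `T` agree.
    bool : ∀ P S T → parity (𝟙 (P ∧ T)) ≡ parity (𝟙 (P ∧ not S)) ⊕ parity (𝟙 (P ∧ ((S ∧ T) ∨ (not S ∧ not T))))
    bool false S     T     = refl
    bool true  false false = refl
    bool true  false true  = refl
    bool true  true  false = refl
    bool true  true  true  = refl
    pointwise : ∀ i j → parity (𝟙 (inverted (σ · τ) i j)) ≡
      parity (𝟙 (inverted σ i j)) ⊕ parity (𝟙 ((i <ᶠ j) ∧ discordant τ (σ ! i) (σ ! j)))
    pointwise i j with i ≟ j
    ... | yes refl rewrite <ᵇ-irrefl (toℕ i) = refl
    ... | no i≢j rewrite lookup-· σ τ i | lookup-· σ τ j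
                       | <ᶠ-flip (i≢j ∘ pσ .injective i j)
                       | <ᶠ-flip (i≢j ∘ sym ∘ pσ .injective j i ∘ pτ .injective (σ ! j) (σ ! i)) =
      bool (i <ᶠ j) (σ ! i <ᶠ σ ! j) (τ ! (σ ! j) <ᶠ τ ! (σ ! i))

  even⇒2∣inversions : (σ : PermV n) → sgn σ ≡ 0ℙ → 2 ∣ inversions σ
  even⇒2∣inversions σ = even⇒2∣ (inversions σ)

  2∣inversions⇒even : (σ : PermV n) → 2 ∣ inversions σ → sgn σ ≡ 0ℙ
  2∣inversions⇒even σ = 2∣⇒even

record Alt (σ : PermV n) : Set where
  constructor alt
  field
    isPerm : Perm σ
    isEven : sgn σ ≡ 0ℙ
open Alt

InA⇒Alt : {σ : PermV n} → InA σ → Alt σ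
InA⇒Alt {σ = σ} (pσ , d) = alt (perm pσ) (2∣inversions⇒even σ d)

Alt⇒InA : {σ : PermV n} → Alt σ → InA σ
Alt⇒InA {σ = σ} (alt pσ e) = pσ .injective , even⇒2∣inversions σ e

⊕-self : ∀ p → p ⊕ p ≡ 0ℙ
⊕-self 0ℙ = refl
⊕-self 1ℙ = refl

⊕-zero⇒≡ : ∀ p r → p ⊕ r ≡ 0ℙ → p ≡ r
⊕-zero⇒≡ 0ℙ r  eq = sym eq
⊕-zero⇒≡ 1ℙ 1ℙ eq = refl

sgn-ι : ∀ n → sgn (ι {n}) ≡ 0ℙ
sgn-ι n = begin
  sgn (ι {n})              ≡⟨ cong sgn ι·ι ⟨
  sgn (ι · ι)              ≡⟨ sgn-· (Perm-ι {n}) Perm-ι ⟩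
  sgn (ι {n}) ⊕ sgn ι      ≡⟨ ⊕-self (sgn (ι {n})) ⟩
  0ℙ                 ∎
  where
  ι·ι : ι · ι ≡ ι {n}
  ι·ι = vec-ext λ i → trans (lookup-· ι ι i) (lookup-ι (ι ! i))

Alt-ι : Alt (ι {n})
Alt-ι {n} = alt Perm-ι (sgn-ι n)

sgn-inv : {σ : PermV n} → Perm σ → sgn (inv σ) ≡ sgn σ
sgn-inv {σ = σ} pσ = ⊕-zero⇒≡ (sgn (inv σ)) (sgn σ)
  (trans (sym (sgn-· (Perm-inv pσ) pσ)) (trans (cong sgn (inv-·ˡ pσ)) (sgn-ι _)))

Alt-· : {σ τ : PermV n} → Alt σ → Alt τ → Alt (σ · τ)
Alt-· (alt pσ eσ) (alt pτ eτ) = alt (Perm-· pσ pτ) (trans (sgn-· pσ pτ) (cong₂ _⊕_ eσ eτ))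

Alt-inv : {σ : PermV n} → Alt σ → Alt (inv σ)
Alt-inv (alt pσ eσ) = alt (Perm-inv pσ) (trans (sgn-inv pσ) eσ)

⊕-conj : ∀ p r → (p ⊕ r) ⊕ p ≡ r
⊕-conj 0ℙ 0ℙ = refl
⊕-conj 0ℙ 1ℙ = refl
⊕-conj 1ℙ 0ℙ = refl
⊕-conj 1ℙ 1ℙ = refl

sgn-conj : {c σ : PermV n} → Perm c → Perm σ → sgn (conj c σ) ≡ sgn σ
sgn-conj {c = c} {σ} pc pσ = begin
  sgn ((inv c · σ) · c)             ≡⟨ sgn-· (Perm-· (Perm-inv pc) pσ) pc ⟩
  sgn (inv c · σ) ⊕ sgn c           ≡⟨ cong (_⊕ sgn c) (sgn-· (Perm-inv pc) pσ) ⟩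
  (sgn (inv c) ⊕ sgn σ) ⊕ sgn c     ≡⟨ cong (λ p → (p ⊕ sgn σ) ⊕ sgn c) (sgn-inv pc) ⟩
  (sgn c ⊕ sgn σ) ⊕ sgn c           ≡⟨ ⊕-conj (sgn c) (sgn σ) ⟩
  sgn σ                             ∎

Perm-conj : {c σ : PermV n} → Perm c → Perm σ → Perm (conj c σ)
Perm-conj pc pσ = Perm-· (Perm-· (Perm-inv pc) pσ) pc

Alt-conj : {c σ : PermV n} → Perm c → Alt σ → Alt (conj c σ)
Alt-conj pc (alt pσ eσ) = alt (Perm-conj pc pσ) (trans (sgn-conj pc pσ) eσ)

lookup-conj : (c σ : PermV n) (i : Fin n) → conj c σ ! i ≡ c ! (σ ! (inv c ! i))
lookup-conj c σ i = trans (lookup-· (inv c · σ) c i) (cong (c !_) (lookup-· (inv c) σ i))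

-- Avoidance, and passing to one point fewer.

Avoid : PermV n → PermV n → Set
Avoid {n} σ τ = ∀ (i : Fin n) → σ ! i ≢ τ ! i

lift₁ : PermV m → PermV (suc m)
lift₁ w = zero ∷ Vec.map suc w

lookup-lift₁ : (w : PermV m) (i : Fin m) → lift₁ w ! suc i ≡ suc (w ! i)
lookup-lift₁ w i = lookup-map i suc w

Perm-lift₁ : {w : PermV m} → Perm w → Perm (lift₁ w)
Perm-lift₁ {w = w} pw .injective zero    zero    eq = refl
Perm-lift₁ {w = w} pw .injective zero    (suc j) eq with () ← trans eq (lookup-lift₁ w j)
Perm-lift₁ {w = w} pw .injective (suc i) zero    eq with () ← trans (sym eq) (lookup-lift₁ w i)
Perm-lift₁ {w = w} pw .injective (suc i) (suc j) eq = cong suc (pw .injective i j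
  (suc-injective (trans (sym (lookup-lift₁ w i)) (trans eq (lookup-lift₁ w j)))))

sum-zero : (f : Fin n → ℕ) → (∀ i → f i ≡ 0) → sum f ≡ 0
sum-zero {zero}  f eq = refl
sum-zero {suc n} f eq rewrite eq zero = sum-zero (f ∘ suc) (eq ∘ suc)

opaque
  unfolding sgn

  sgn-lift₁ : (w : PermV m) → sgn (lift₁ w) ≡ sgn w
  sgn-lift₁ w = cong parity (trans (inversions≡Σ₂ (lift₁ w))
    (trans (cong₂ ℕ._+_ (sum-zero (λ j → 𝟙 (inverted (lift₁ w) zero (suc j))) (λ _ → refl))
                        (Σ₂-cong λ i j → cong₂ (λ a b → 𝟙 ((i <ᶠ j) ∧ (a <ᶠ b))) (lookup-lift₁ w j) (lookup-lift₁ w i)))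
           (sym (inversions≡Σ₂ w))))

unsuc : Fin m → Fin (suc m) → Fin m
unsuc d zero    = d
unsuc d (suc j) = j

-- Deletes row 0 and column 0: the point mapped to 0 is rerouted to the image of 0.
drop₁ : PermV (suc m) → PermV m
drop₁ X = tabulate λ i → unsuc (unsuc i (X ! zero)) (X ! suc i)

lookup-drop₁ : (X : PermV (suc m)) (i : Fin m) {t : Fin m} → X ! suc i ≡ suc t → drop₁ X ! i ≡ t
lookup-drop₁ X i eq = trans (lookup∘tabulate _ i) (cong (unsuc _) eq)

Perm-drop₁ : {X : PermV (suc m)} → Perm X → Perm (drop₁ X)
Perm-drop₁ {X = X} pX .injective i j eq =
  inj (trans (sym (lookup∘tabulate _ i)) (trans eq (lookup∘tabulate _ j)))
  where
  go : ∀ {i j} x a b → X ! zero ≡ x → X ! suc i ≡ a → X ! suc j ≡ b →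
       unsuc (unsuc i x) a ≡ unsuc (unsuc j x) b → i ≡ j
  go {i} {j} x zero zero e₀ eᵢ eⱼ eq = suc-injective (pX .injective (suc i) (suc j) (trans eᵢ (sym eⱼ)))
  go {i} {j} x (suc s) (suc t) e₀ eᵢ eⱼ refl = suc-injective (pX .injective (suc i) (suc j) (trans eᵢ (sym eⱼ)))
  go {i} {j} zero zero (suc t) e₀ eᵢ eⱼ eq with () ← pX .injective zero (suc i) (trans e₀ (sym eᵢ))
  go {i} {j} (suc x) zero (suc t) e₀ eᵢ eⱼ refl with () ← pX .injective zero (suc j) (trans e₀ (sym eⱼ))
  go {i} {j} zero (suc s) zero e₀ eᵢ eⱼ eq with () ← pX .injective zero (suc j) (trans e₀ (sym eⱼ))
  go {i} {j} (suc x) (suc s) zero e₀ eᵢ eⱼ refl with () ← pX .injective zero (suc i) (trans e₀ (sym eᵢ))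
  inj : unsuc (unsuc i (X ! zero)) (X ! suc i) ≡ unsuc (unsuc j (X ! zero)) (X ! suc j) → i ≡ j
  inj = go _ _ _ refl refl refl

module _ (X : PermV (suc m)) (w : PermV m) where

  -- A coincidence in a later row has a nonzero value, and `drop₁` leaves such entries in place, so
  -- it would already be a coincidence of `drop₁ X` with `w`.
  Avoid-lift₁ : X ! zero ≢ zero → Avoid (drop₁ X) w → Avoid X (lift₁ w)
  Avoid-lift₁ X₀≢0 a zero    eq = X₀≢0 eq
  Avoid-lift₁ X₀≢0 a (suc i) eq = a i (lookup-drop₁ X i (trans eq (lookup-lift₁ w i)))

module _ (X : PermV (2 ℕ.+ m)) (w : PermV m) where

  Avoid-lift₂ : X ! zero ≢ zero → X ! suc zero ≢ suc zero →
    Avoid (drop₁ (drop₁ X)) w → Avoid X (lift₁ (lift₁ w))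
  Avoid-lift₂ X₀≢0 X₁≢1 a zero          eq = X₀≢0 eq
  Avoid-lift₂ X₀≢0 X₁≢1 a (suc zero)    eq = X₁≢1 eq
  Avoid-lift₂ X₀≢0 X₁≢1 a (suc (suc i)) eq = a i (lookup-drop₁ (drop₁ X) i (lookup-drop₁ X (suc i)
    (trans eq (trans (lookup-lift₁ (lift₁ w) (suc i)) (cong suc (lookup-lift₁ w i))))))

module _ (X : PermV (3 ℕ.+ m)) (w : PermV m) where

  Avoid-lift₃ : X ! zero ≢ zero → X ! suc zero ≢ suc zero → X ! suc (suc zero) ≢ suc (suc zero) →
    Avoid (drop₁ (drop₁ (drop₁ X))) w → Avoid X (lift₁ (lift₁ (lift₁ w)))
  Avoid-lift₃ X₀≢0 X₁≢1 X₂≢2 a zero                eq = X₀≢0 eq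
  Avoid-lift₃ X₀≢0 X₁≢1 X₂≢2 a (suc zero)          eq = X₁≢1 eq
  Avoid-lift₃ X₀≢0 X₁≢1 X₂≢2 a (suc (suc zero))    eq = X₂≢2 eq
  Avoid-lift₃ X₀≢0 X₁≢1 X₂≢2 a (suc (suc (suc i))) eq =
    a i (lookup-drop₁ (drop₁ (drop₁ X)) i (lookup-drop₁ (drop₁ X) (suc i) (lookup-drop₁ X (suc (suc i))
      (trans eq (trans (lookup-lift₁ (lift₁ (lift₁ w)) (suc (suc i)))
        (cong suc (trans (lookup-lift₁ (lift₁ w) (suc i)) (cong suc (lookup-lift₁ w i)))))))))

-- Transpositions, and permutations with prescribed images.

swap : Fin n → Fin n → PermV n
swap i j = tabulate (transpose i j)

lookup-swap : (i j k : Fin n) → swap i j ! k ≡ transpose i j k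
lookup-swap i j k = lookup∘tabulate _ k

Perm-swap : (i j : Fin n) → Perm (swap i j)
Perm-swap i j .injective k l eq = begin
  k                                  ≡⟨ transpose-inverse j i ⟨
  transpose j i (transpose i j k)    ≡⟨ cong (transpose j i) (trans (sym (lookup-swap i j k)) (trans eq (lookup-swap i j l))) ⟩
  transpose j i (transpose i j l)    ≡⟨ transpose-inverse j i ⟩
  l                                  ∎

swap-left : (i j : Fin n) → swap i j ! i ≡ j
swap-left i j rewrite lookup-swap i j i with i ≟ i
... | yes _  = refl
... | no i≢i = ⊥-elim (i≢i refl)

swap-right : (i j : Fin n) → swap i j ! j ≡ i
swap-right i j rewrite lookup-swap i j j with j ≟ i
... | yes j≡i = j≡i
... | no _ with j ≟ j
...   | yes _  = refl
...   | no j≢j = ⊥-elim (j≢j refl)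

swap-other : {i j k : Fin n} → k ≢ i → k ≢ j → swap i j ! k ≡ k
swap-other {i = i} {j} {k} k≢i k≢j rewrite lookup-swap i j k with k ≟ i
... | yes k≡i = ⊥-elim (k≢i k≡i)
... | no _ with k ≟ j
...   | yes k≡j = ⊥-elim (k≢j k≡j)
...   | no _    = refl

module _ {L : PermV n} (pL : Perm L) (a k : Fin n) where

  -- Besides `a`, only the point that `L` sends to `k` can change its image, so several images can
  -- be prescribed one after another.
  aim : PermV n
  aim = swap a (inv L ! k) · L

  Perm-aim : Perm aim
  Perm-aim = Perm-· (Perm-swap a (inv L ! k)) pL

  lookup-aim : aim ! a ≡ k
  lookup-aim = trans (lookup-· (swap a (inv L ! k)) L a)
    (trans (cong (L !_) (swap-left a (inv L ! k))) (lookup-inv-· pL k))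

  lookup-aim-other : ∀ {b} → b ≢ a → L ! b ≢ k → aim ! b ≡ L ! b
  lookup-aim-other {b} b≢a Lb≢k = trans (lookup-· (swap a (inv L ! k)) L b)
    (cong (L !_) (swap-other b≢a λ b≡ → Lb≢k (trans (cong (L !_) b≡) (lookup-inv-· pL k))))

transporter₂ : {i j : Fin (2 ℕ.+ n)} → i ≢ j → ∃ λ L → Perm L × L ! zero ≡ i × L ! suc zero ≡ j
transporter₂ {n} {i} {j} i≢j = aim p₀ (suc zero) j , Perm-aim p₀ (suc zero) j ,
  trans (lookup-aim-other p₀ (suc zero) j {zero} (λ ()) (λ eq → i≢j (trans (sym 0↦i) eq))) 0↦i ,
  lookup-aim p₀ (suc zero) j
  where
  p₀ : Perm (aim (Perm-ι {2 ℕ.+ n}) zero i)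
  p₀ = Perm-aim Perm-ι zero i
  0↦i : aim (Perm-ι {2 ℕ.+ n}) zero i ! zero ≡ i
  0↦i = lookup-aim Perm-ι zero i

transporter₃ : {i j k : Fin (3 ℕ.+ n)} → i ≢ j → i ≢ k → j ≢ k →
  ∃ λ L → Perm L × L ! zero ≡ i × L ! suc zero ≡ j × L ! suc (suc zero) ≡ k
transporter₃ {n} {i} {j} {k} i≢j i≢k j≢k =
  let L , pL , 0↦i , 1↦j = transporter₂ i≢j
  in aim pL (suc (suc zero)) k , Perm-aim pL (suc (suc zero)) k ,
     trans (lookup-aim-other pL (suc (suc zero)) k {zero} (λ ()) (λ eq → i≢k (trans (sym 0↦i) eq))) 0↦i ,
     trans (lookup-aim-other pL (suc (suc zero)) k {suc zero} (λ ()) (λ eq → j≢k (trans (sym 1↦j) eq))) 1↦j ,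
     lookup-aim pL (suc (suc zero)) k

-- Common avoiders of two permutations, through a prescribed cell.

other : (a b : Fin (3 ℕ.+ n)) → ∃ λ c → c ≢ a × c ≢ b
other zero          zero          = suc zero , (λ ()) , (λ ())
other zero          (suc zero)    = suc (suc zero) , (λ ()) , (λ ())
other zero          (suc (suc b)) = suc zero , (λ ()) , (λ ())
other (suc zero)    zero          = suc (suc zero) , (λ ()) , (λ ())
other (suc (suc a)) zero          = suc zero , (λ ()) , (λ ())
other (suc a)       (suc b)       = zero , (λ ()) , (λ ())

-- Both parities are required even though only even avoiders are wanted, because relabelling rows
-- and columns by odd permutations changes the sign.
CommonAvoider : ℕ → Set
CommonAvoider n = {x y : PermV n} → Perm x → Perm y → (b : Parity) →
  ∃ λ v → Perm v × sgn v ≡ b × Avoid x v × Avoid y v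

-- Undoes a relabelling of the rows by `L` and of the columns by `R` in the permutation matrix;
-- `push` below is the relabelling itself.
pull : PermV n → PermV n → PermV n → PermV n
pull L R w = inv L · (w · inv R)

module _ {L R : PermV n} (pL : Perm L) (pR : Perm R) where

  Perm-pull : {w : PermV n} → Perm w → Perm (pull L R w)
  Perm-pull pw = Perm-· (Perm-inv pL) (Perm-· pw (Perm-inv pR))

  sgn-pull : {w : PermV n} → Perm w → sgn (pull L R w) ≡ sgn L ⊕ (sgn w ⊕ sgn R)
  sgn-pull {w} pw = begin
    sgn (inv L · (w · inv R))           ≡⟨ sgn-· (Perm-inv pL) (Perm-· pw (Perm-inv pR)) ⟩
    sgn (inv L) ⊕ sgn (w · inv R)       ≡⟨ cong₂ _⊕_ (sgn-inv pL) (sgn-· pw (Perm-inv pR)) ⟩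
    sgn L ⊕ (sgn w ⊕ sgn (inv R))       ≡⟨ cong (λ p → sgn L ⊕ (sgn w ⊕ p)) (sgn-inv pR) ⟩
    sgn L ⊕ (sgn w ⊕ sgn R)             ∎

  lookup-pull : (w : PermV n) (t : Fin n) → R ! (pull L R w ! (L ! t)) ≡ w ! t
  lookup-pull w t = begin
    R ! (pull L R w ! (L ! t))                  ≡⟨ cong (R !_) (lookup-· (inv L) (w · inv R) (L ! t)) ⟩
    R ! ((w · inv R) ! (inv L ! (L ! t)))       ≡⟨ cong (R !_) (lookup-· w (inv R) (inv L ! (L ! t))) ⟩
    R ! (inv R ! (w ! (inv L ! (L ! t))))       ≡⟨ lookup-inv-· pR _ ⟩
    w ! (inv L ! (L ! t))                       ≡⟨ cong (w !_) (lookup-·-inv pL t) ⟩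
    w ! t                                       ∎

  push : PermV n → PermV n
  push x = L · (x · R)

  Perm-push : {x : PermV n} → Perm x → Perm (push x)
  Perm-push px = Perm-· pL (Perm-· px pR)

  lookup-push : (x : PermV n) (t : Fin n) → push x ! t ≡ R ! (x ! (L ! t))
  lookup-push x t = trans (lookup-· L (x · R) t) (lookup-· x R (L ! t))

  Avoid-pull : (x w : PermV n) → Avoid (push x) w → Avoid x (pull L R w)
  Avoid-pull x w a k eq = a (inv L ! k) (begin
    push x ! t                         ≡⟨ lookup-push x t ⟩
    R ! (x ! (L ! t))                  ≡⟨ cong (λ l → R ! (x ! l)) Lt≡k ⟩
    R ! (x ! k)                        ≡⟨ cong (R !_) eq ⟩
    R ! (pull L R w ! k)               ≡⟨ cong (λ l → R ! (pull L R w ! l)) Lt≡k ⟨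
    R ! (pull L R w ! (L ! t))         ≡⟨ lookup-pull w t ⟩
    w ! t                              ∎)
    where
    t : Fin n
    t = inv L ! k
    Lt≡k : L ! t ≡ k
    Lt≡k = lookup-inv-· pL k

⊕-sandwich : ∀ l b r → l ⊕ ((l ⊕ (b ⊕ r)) ⊕ r) ≡ b
⊕-sandwich 0ℙ 0ℙ 0ℙ = refl
⊕-sandwich 0ℙ 0ℙ 1ℙ = refl
⊕-sandwich 0ℙ 1ℙ 0ℙ = refl
⊕-sandwich 0ℙ 1ℙ 1ℙ = refl
⊕-sandwich 1ℙ 0ℙ 0ℙ = refl
⊕-sandwich 1ℙ 0ℙ 1ℙ = refl
⊕-sandwich 1ℙ 1ℙ 0ℙ = refl
⊕-sandwich 1ℙ 1ℙ 1ℙ = refl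

Through : PermV n → PermV n → Fin n → Fin n → Parity → Set
Through x y i j b = ∃ λ v → Perm v × sgn v ≡ b × v ! i ≡ j × Avoid x v × Avoid y v

CommonAvoiderThrough : ℕ → Set
CommonAvoiderThrough n = {x y : PermV n} → Perm x → Perm y →
  (i j : Fin n) → x ! i ≢ j → y ! i ≢ j → (b : Parity) → Through x y i j b

pull-Through : {L R : PermV n} (pL : Perm L) (pR : Perm R) (x y : PermV n) (t : Fin n) {i j j′ : Fin n} {b : Parity} →
  L ! t ≡ i → R ! j ≡ j′ → Through (push pL pR x) (push pL pR y) t j′ (sgn L ⊕ (b ⊕ sgn R)) → Through x y i j b
pull-Through {L = L} {R} pL pR x y t {b = b} refl refl (w , pw , ew , wt , xw , yw) =
  pull L R w , Perm-pull pL pR pw ,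
  trans (sgn-pull pL pR pw) (trans (cong (λ p → sgn L ⊕ (p ⊕ sgn R)) ew) (⊕-sandwich (sgn L) b (sgn R))) ,
  pR .injective _ _ (trans (lookup-pull pL pR w t) wt) ,
  Avoid-pull pL pR x w xw , Avoid-pull pL pR y w yw

-- Two transpositions move the cell to the corner (0, 0). Deleting its row and column leaves a
-- problem without prescribed cell, and the parity left to unification is the one that the
-- relabelling turns into `b`.
through : CommonAvoider m → CommonAvoiderThrough (suc m)
through {m} avoider {x} {y} px py i j xᵢ≢j yᵢ≢j b =
  let w , pw , ew , xw , yw = avoider (Perm-drop₁ (Perm-push pL pR px)) (Perm-drop₁ (Perm-push pL pR py)) _
  in pull-Through pL pR x y zero (swap-left zero i) (swap-right zero j)
       (lift₁ w , Perm-lift₁ pw , trans (sgn-lift₁ w) ew , refl ,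
        Avoid-lift₁ (push pL pR x) w (corner x xᵢ≢j) xw , Avoid-lift₁ (push pL pR y) w (corner y yᵢ≢j) yw)
  where
  L R : PermV (suc m)
  L = swap zero i
  R = swap zero j
  pL : Perm L
  pL = Perm-swap zero i
  pR : Perm R
  pR = Perm-swap zero j
  corner : ∀ x → x ! i ≢ j → push pL pR x ! zero ≢ zero
  corner x xᵢ≢j eq = xᵢ≢j (pR .injective _ _ (begin
    R ! (x ! i)              ≡⟨ cong (λ k → R ! (x ! k)) (swap-left zero i) ⟨
    R ! (x ! (L ! zero))     ≡⟨ lookup-push pL pR x zero ⟨
    push pL pR x ! zero      ≡⟨ eq ⟩
    zero                     ≡⟨ swap-right zero j ⟨
    R ! j                    ∎))

isPerm? : (σ : PermV n) → Dec (IsPerm σ)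
isPerm? σ = all? λ i → all? λ j → (σ ! i ≟ σ ! j) →-dec (i ≟ j)

-- The derangements with 0 ↦ 1.
derangements₅ : L.List (PermV 5)
derangements₅ = L.map (Vec.map (_mod 5))
  ( (1 ∷ 0 ∷ 3 ∷ 4 ∷ 2 ∷ []) L.∷ (1 ∷ 0 ∷ 4 ∷ 2 ∷ 3 ∷ []) L.∷ (1 ∷ 2 ∷ 0 ∷ 4 ∷ 3 ∷ []) L.∷ (1 ∷ 2 ∷ 3 ∷ 4 ∷ 0 ∷ [])
  L.∷ (1 ∷ 2 ∷ 4 ∷ 0 ∷ 3 ∷ []) L.∷ (1 ∷ 3 ∷ 0 ∷ 4 ∷ 2 ∷ []) L.∷ (1 ∷ 3 ∷ 4 ∷ 0 ∷ 2 ∷ []) L.∷ (1 ∷ 3 ∷ 4 ∷ 2 ∷ 0 ∷ [])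
  L.∷ (1 ∷ 4 ∷ 0 ∷ 2 ∷ 3 ∷ []) L.∷ (1 ∷ 4 ∷ 3 ∷ 0 ∷ 2 ∷ []) L.∷ (1 ∷ 4 ∷ 3 ∷ 2 ∷ 0 ∷ []) L.∷ L.[])

opaque
  unfolding sgn

  sgn? : (σ : PermV n) (b : Parity) → Dec (sgn σ ≡ b)
  sgn? σ b = sgn σ ℙP.≟ b

  -- The normalised base case: one permutation is the identity, the cell is (0, 1), and the other
  -- permutation runs through everything missing that cell. Its entries come one at a time with
  -- their distinctness conditions, so the search discards non-injective prefixes early.
  avoider₅ : (a : Fin 5) → a ≢ suc zero → (b : Fin 5) → b ≢ a → (c : Fin 5) → c ≢ a → c ≢ b →
    (d : Fin 5) → d ≢ a → d ≢ b → d ≢ c → (e : Fin 5) → e ≢ a → e ≢ b → e ≢ c → e ≢ d → (p : Parity) →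
    Any (λ v → Avoid (a ∷ b ∷ c ∷ d ∷ e ∷ []) v × sgn v ≡ p × IsPerm v × v ! zero ≡ suc zero × Avoid ι v) derangements₅
  avoider₅ = toWitness {a? = all? λ a → ¬? (a ≟ suc zero) →-dec all? λ b → ¬? (b ≟ a) →-dec
    all? λ c → ¬? (c ≟ a) →-dec ¬? (c ≟ b) →-dec
    all? λ d → ¬? (d ≟ a) →-dec ¬? (d ≟ b) →-dec ¬? (d ≟ c) →-dec
    all? λ e → ¬? (e ≟ a) →-dec ¬? (e ≟ b) →-dec ¬? (e ≟ c) →-dec ¬? (e ≟ d) →-dec
    allParity? λ p → anyList? (λ v → (all? λ i → ¬? ((a ∷ b ∷ c ∷ d ∷ e ∷ []) ! i ≟ v ! i)) ×-dec sgn? v p ×-dec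
      isPerm? v ×-dec (v ! zero ≟ suc zero) ×-dec (all? λ i → ¬? (ι ! i ≟ v ! i))) derangements₅} tt
    where
    allParity? : {P : Parity → Set} → (∀ p → Dec (P p)) → Dec (∀ p → P p)
    allParity? P? = map′ (λ { (p₀ , p₁) 0ℙ → p₀ ; (p₀ , p₁) 1ℙ → p₁ }) (λ p → p 0ℙ , p 1ℙ) (P? 0ℙ ×-dec P? 1ℙ)

lookups-distinct : {σ : PermV n} → Perm σ → ∀ {i j} → i ≢ j → σ ! i ≢ σ ! j
lookups-distinct pσ i≢j eq = i≢j (pσ .injective _ _ eq)

-- Choose `L` with 0 sent to the image of `i` under `x` and 1 sent to `j`, which is possible because
-- these differ. Rows relabelled by `L · inv x` and columns by `inv L` turn `x` into the identity
-- and the cell into (0, 1), leaving `y` to the search.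
through₅ : CommonAvoiderThrough 5
through₅ {x} {y} px py i j xᵢ≢j yᵢ≢j b =
  let L , pL , 0↦xᵢ , 1↦j = transporter₂ xᵢ≢j
  in solve L pL 0↦xᵢ 1↦j
  where
  solve : ∀ L → Perm L → L ! zero ≡ x ! i → L ! suc zero ≡ j → Through x y i j b
  solve L pL 0↦xᵢ 1↦j = pull-Through pL′ pR x y zero 0↦i j↦1 (find (push pL′ pR y) (Perm-push pL′ pR py) corner)
    where
    L′ R : PermV 5
    L′ = L · inv x
    R  = inv L
    pL′ : Perm L′
    pL′ = Perm-· pL (Perm-inv px)
    pR : Perm R
    pR = Perm-inv pL
    0↦i : L′ ! zero ≡ i
    0↦i = trans (lookup-· L (inv x) zero) (trans (cong (inv x !_) 0↦xᵢ) (lookup-·-inv px i))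
    j↦1 : R ! j ≡ suc zero
    j↦1 = trans (cong (R !_) (sym 1↦j)) (lookup-·-inv pL (suc zero))
    corner : push pL′ pR y ! zero ≢ suc zero
    corner eq = yᵢ≢j (pR .injective _ _ (trans (cong (λ k → R ! (y ! k)) (sym 0↦i))
      (trans (sym (lookup-push pL′ pR y zero)) (trans eq (sym j↦1)))))
    push-x : ∀ t → push pL′ pR x ! t ≡ ι ! t
    push-x t = begin
      push pL′ pR x ! t                 ≡⟨ lookup-push pL′ pR x t ⟩
      R ! (x ! (L′ ! t))                ≡⟨ cong (λ k → R ! (x ! k)) (lookup-· L (inv x) t) ⟩
      R ! (x ! (inv x ! (L ! t)))       ≡⟨ cong (R !_) (lookup-inv-· px (L ! t)) ⟩
      R ! (L ! t)                       ≡⟨ lookup-·-inv pL t ⟩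
      t                                 ≡⟨ lookup-ι t ⟨
      ι ! t                             ∎
    find : ∀ y → Perm y → y ! zero ≢ suc zero → ∀ {p} → Through (push pL′ pR x) y zero (suc zero) p
    find (a ∷ b ∷ c ∷ d ∷ e ∷ []) p a≢1 {s} =
      let v , av , sv , pv , v₀ , ιv = satisfied (avoider₅ a a≢1
            b (lookups-distinct p {1F} {0F} λ ())
            c (lookups-distinct p {2F} {0F} λ ()) (lookups-distinct p {2F} {1F} λ ())
            d (lookups-distinct p {3F} {0F} λ ()) (lookups-distinct p {3F} {1F} λ ()) (lookups-distinct p {3F} {2F} λ ())
            e (lookups-distinct p {4F} {0F} λ ()) (lookups-distinct p {4F} {1F} λ ()) (lookups-distinct p {4F} {2F} λ ()) (lookups-distinct p {4F} {3F} λ ()) s)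
      in v , perm pv , sv , v₀ , (λ t eq → ιv t (trans (sym (push-x t)) eq)) , av

-- Mutual induction on the size: an unconstrained avoider is obtained through a cell of row 0 that
-- both permutations miss, and a constrained one from an unconstrained one of size one less.
avoider : ∀ k → CommonAvoider (5 ℕ.+ k)
throughAll : ∀ k → CommonAvoiderThrough (5 ℕ.+ k)
avoider k {x} {y} px py b =
  let c , c≢x , c≢y = other (x ! zero) (y ! zero)
      v , pv , ev , _ , xv , yv = throughAll k px py zero c (c≢x ∘ sym) (c≢y ∘ sym) b
  in v , pv , ev , xv , yv
throughAll zero    = through₅
throughAll (suc k) = through (avoider k)

-- Avoiders of v that agree with h at two or three points.

single-avoider : ∀ k {x : PermV (4 ℕ.+ k)} → Perm x → (b : Parity) → ∃ λ v → Perm v × sgn v ≡ b × Avoid x v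
single-avoider (suc k) px b = let v , pv , ev , xv , _ = avoider k px px b in v , pv , ev , xv
-- Size 4 arises when two points are deleted from 6 or three from 7. It suffices to multiply `x` by
-- a derangement, and four points carry derangements of both signs.
single-avoider zero {x} px b = let w , pw , ew , ιw = derangement (sgn x ⊕ b) in
  x · w , Perm-· px pw , trans (sgn-· px pw) (trans (cong (sgn x ⊕_) ew) (⊕-cancel (sgn x) b)) ,
  λ i eq → ιw (x ! i) (trans eq (lookup-· x w i))
  where
  ⊕-cancel : ∀ p r → p ⊕ (p ⊕ r) ≡ r
  ⊕-cancel 0ℙ r  = refl
  ⊕-cancel 1ℙ 0ℙ = refl
  ⊕-cancel 1ℙ 1ℙ = refl
  opaque
    unfolding sgn
    derangement : ∀ p → ∃ λ (w : PermV 4) → Perm w × sgn w ≡ p × (∀ i → i ≢ w ! i)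
    derangement 0ℙ = w , perm (toWitness {a? = isPerm? w} tt) , refl , toWitness {a? = all? λ i → ¬? (i ≟ w ! i)} tt
      where
      w : PermV 4
      w = 1F ∷ 0F ∷ 3F ∷ 2F ∷ []
    derangement 1ℙ = w , perm (toWitness {a? = isPerm? w} tt) , refl , toWitness {a? = all? λ i → ¬? (i ≟ w ! i)} tt
      where
      w : PermV 4
      w = 1F ∷ 2F ∷ 3F ∷ 0F ∷ []

-- Relabelling rows by L and columns by R takes h to the identity, so agreeing with h becomes fixing points.
module Relabel {h v L : PermV n} (ph : Perm h) (pv : Perm v) (pL : Perm L) where

  R : PermV n
  R = inv h · inv L

  pR : Perm R
  pR = Perm-· (Perm-inv ph) (Perm-inv pL)

  R∘h∘L : ∀ t → R ! (h ! (L ! t)) ≡ t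
  R∘h∘L t = begin
    R ! (h ! (L ! t))                    ≡⟨ lookup-· (inv h) (inv L) _ ⟩
    inv L ! (inv h ! (h ! (L ! t)))      ≡⟨ cong (inv L !_) (lookup-·-inv ph (L ! t)) ⟩
    inv L ! (L ! t)                      ≡⟨ lookup-·-inv pL t ⟩
    t                                    ∎

  U : PermV n
  U = push pL pR v

  pU : Perm U
  pU = Perm-push pL pR pv

  agrees : ∀ {w t} → w ! t ≡ t → pull L R w ! (L ! t) ≡ h ! (L ! t)
  agrees {w} {t} wt = pR .injective _ _ (trans (lookup-pull pL pR w t) (trans wt (sym (R∘h∘L t))))

  moves : ∀ {t} → h ! (L ! t) ≢ v ! (L ! t) → U ! t ≢ t
  moves {t} ne eq = ne (pR .injective _ _ (trans (R∘h∘L t) (trans (sym eq) (lookup-push pL pR v t))))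

  sgn-R : sgn R ≡ sgn h ⊕ sgn L
  sgn-R = trans (sgn-· (Perm-inv ph) (Perm-inv pL)) (cong₂ _⊕_ (sgn-inv ph) (sgn-inv pL))

  sgn-relabel : ∀ {w} → Perm w → sgn (pull L R w) ≡ sgn w ⊕ sgn h
  sgn-relabel {w} pw = begin
    sgn (pull L R w)                        ≡⟨ sgn-pull pL pR pw ⟩
    sgn L ⊕ (sgn w ⊕ sgn R)                 ≡⟨ cong (λ p → sgn L ⊕ (sgn w ⊕ p)) sgn-R ⟩
    sgn L ⊕ (sgn w ⊕ (sgn h ⊕ sgn L))       ≡⟨ cancel (sgn L) (sgn w) (sgn h) ⟩
    sgn w ⊕ sgn h                           ∎
    where
    cancel : ∀ l w h → l ⊕ (w ⊕ (h ⊕ l)) ≡ w ⊕ h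
    cancel 0ℙ 0ℙ 0ℙ = refl
    cancel 0ℙ 0ℙ 1ℙ = refl
    cancel 0ℙ 1ℙ 0ℙ = refl
    cancel 0ℙ 1ℙ 1ℙ = refl
    cancel 1ℙ 0ℙ 0ℙ = refl
    cancel 1ℙ 0ℙ 1ℙ = refl
    cancel 1ℙ 1ℙ 0ℙ = refl
    cancel 1ℙ 1ℙ 1ℙ = refl

  sgn-U : sgn v ≡ 0ℙ → sgn h ≡ 0ℙ → sgn U ≡ 0ℙ
  sgn-U ev eh = begin
    sgn U                                     ≡⟨ sgn-· pL (Perm-· pv pR) ⟩
    sgn L ⊕ sgn (v · R)                       ≡⟨ cong (sgn L ⊕_) (sgn-· pv pR) ⟩
    sgn L ⊕ (sgn v ⊕ sgn R)                   ≡⟨ cong₂ (λ p r → sgn L ⊕ (p ⊕ r)) ev sgn-R ⟩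
    sgn L ⊕ (sgn h ⊕ sgn L)                   ≡⟨ cong (λ p → sgn L ⊕ (p ⊕ sgn L)) eh ⟩
    sgn L ⊕ sgn L                             ≡⟨ ⊕-self (sgn L) ⟩
    0ℙ                                        ∎

  Alt-relabel : sgn h ≡ 0ℙ → ∀ {w} → Alt w → Alt (pull L R w)
  Alt-relabel eh (alt pw ew) = alt (Perm-pull pL pR pw) (trans (sgn-relabel pw) (cong₂ _⊕_ ew eh))

  Avoid-relabel : ∀ {w} → Avoid U w → Avoid v (pull L R w)
  Avoid-relabel {w} = Avoid-pull pL pR v w

  relabel : sgn h ≡ 0ℙ → ∀ {w} → Alt w → Avoid U w →
    ∃ λ x → Alt x × (∀ t → w ! t ≡ t → x ! (L ! t) ≡ h ! (L ! t)) × Avoid v x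
  relabel eh {w} aw Uw = pull L R w , Alt-relabel eh aw , (λ t → agrees {w} {t}) , Avoid-relabel {w} Uw

Alt-lift₁ : {w : PermV m} → Alt w → Alt (lift₁ w)
Alt-lift₁ {w = w} (alt pw ew) = alt (Perm-lift₁ pw) (trans (sgn-lift₁ w) ew)

FixingAvoider : PermV n → L.List (Fin n) → Set
FixingAvoider U ts = ∃ λ w → Alt w × All (λ t → w ! t ≡ t) ts × Avoid U w

-- The two-point and three-point cases differ only in the argument that solves the problem for h =
-- identity. The evenness of `U` is passed on as an implication, since the two-point case does not
-- fix the sign of `v`.
agreeVia : {h v L : PermV n} → Alt h → Perm v → Perm L → (ts : L.List (Fin n)) →
  All (λ t → h ! (L ! t) ≢ v ! (L ! t)) ts →
  (∀ {U} → Perm U → (sgn v ≡ 0ℙ → sgn U ≡ 0ℙ) → All (λ t → U ! t ≢ t) ts → FixingAvoider U ts) →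
  ∃ λ x → Alt x × All (λ t → x ! (L ! t) ≡ h ! (L ! t)) ts × Avoid v x
agreeVia (alt ph eh) pv pL ts moved fixing
  with fixing (Relabel.pU ph pv pL) (λ ev → Relabel.sgn-U ph pv pL ev eh) (All-map (Relabel.moves ph pv pL) moved)
... | w , aw , fixed , Uw with Relabel.relabel ph pv pL eh aw Uw
...   | x , ax , agree , vx = x , ax , All-map (agree _) fixed , vx

fixing₂ : ∀ k {U : PermV (6 ℕ.+ k)} → Perm U → U ! 0F ≢ 0F → U ! 1F ≢ 1F → FixingAvoider U (0F L.∷ 1F L.∷ L.[])
fixing₂ k {U} pU U₀≢0 U₁≢1 with single-avoider k (Perm-drop₁ (Perm-drop₁ pU)) 0ℙ
... | w , pw , ew , aw =
  lift₁ (lift₁ w) , Alt-lift₁ (Alt-lift₁ (alt pw ew)) , refl ∷ refl ∷ [] , Avoid-lift₂ U w U₀≢0 U₁≢1 aw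

agree₂ : ∀ k {h v : PermV (6 ℕ.+ k)} → Alt h → Perm v → {a b : Fin (6 ℕ.+ k)} → a ≢ b →
  h ! a ≢ v ! a → h ! b ≢ v ! b → ∃ λ x → Alt x × x ! a ≡ h ! a × x ! b ≡ h ! b × Avoid v x
agree₂ k {h} {v} ah pv a≢b ha≢va hb≢vb =
  let L , pL , 0↦a , 1↦b = transporter₂ a≢b
      x , ax , agree , vx = agreeVia ah pv pL (0F L.∷ 1F L.∷ L.[])
        (subst (λ i → h ! i ≢ v ! i) (sym 0↦a) ha≢va ∷ subst (λ i → h ! i ≢ v ! i) (sym 1↦b) hb≢vb ∷ [])
        (λ { pU _ (U₀≢0 ∷ U₁≢1 ∷ []) → fixing₂ k pU U₀≢0 U₁≢1 })
  in x , ax , subst (λ i → x ! i ≡ h ! i) 0↦a (All-head agree) , subst (λ i → x ! i ≡ h ! i) 1↦b (All-head (All-tail agree)) , vx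

-- Fixing 0, 1, 2 among six points leaves three points, whose even permutations are exactly these.
rotations₆ : L.List (PermV 6)
rotations₆ = ι L.∷ (0F ∷ 1F ∷ 2F ∷ 4F ∷ 5F ∷ 3F ∷ []) L.∷ (0F ∷ 1F ∷ 2F ∷ 5F ∷ 3F ∷ 4F ∷ []) L.∷ L.[]

-- The transversals of all three rotations.
oddTriples : L.List (Fin 6 × Fin 6 × Fin 6)
oddTriples = (3F , 5F , 4F) L.∷ (5F , 4F , 3F) L.∷ (4F , 3F , 5F) L.∷ L.[]

RotationAvoiding : (d e f : Fin 6) → Set
RotationAvoiding d e f = Any (λ w → d ≢ w ! 3F × e ≢ w ! 4F × f ≢ w ! 5F) rotations₆

-- The rotations differ pairwise in each of the rows 3, 4, 5, so each of `d`, `e`, `f` spoils at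
-- most one of them. All three are spoiled only when the entries form a permutation of {3, 4, 5}
-- meeting each rotation once, that is, an odd one.
rotation-or-odd : (d e : Fin 6) → d ≢ e → (f : Fin 6) → d ≢ f → e ≢ f → RotationAvoiding d e f ⊎ Any (λ t → t ≡ (d , e , f)) oddTriples
rotation-or-odd = toWitness {a? = all? λ d → all? λ e → ¬? (d ≟ e) →-dec all? λ f → ¬? (d ≟ f) →-dec ¬? (e ≟ f) →-dec
  (anyList? (λ w → ¬? (d ≟ w ! 3F) ×-dec ¬? (e ≟ w ! 4F) ×-dec ¬? (f ≟ w ! 5F)) rotations₆ ⊎-dec
  anyList? (λ t → Product.≡-dec _≟_ (Product.≡-dec _≟_ _≟_) t (d , e , f)) oddTriples)} tt

OnlyOddCompletions : Fin 6 × Fin 6 × Fin 6 → Set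
OnlyOddCompletions (d , e , f) = (a : Fin 6) → a ≢ 0F → a ≢ d → a ≢ e → a ≢ f →
  (b : Fin 6) → b ≢ 1F → b ≢ a → b ≢ d → b ≢ e → b ≢ f →
  (c : Fin 6) → c ≢ 2F → c ≢ a → c ≢ b → c ≢ d → c ≢ e → c ≢ f → sgn (a ∷ b ∷ c ∷ d ∷ e ∷ f ∷ []) ≡ 1ℙ

opaque
  unfolding sgn sgn?

  rotations-fix : All (λ w → IsPerm w × sgn w ≡ 0ℙ × w ! 0F ≡ 0F × w ! 1F ≡ 1F × w ! 2F ≡ 2F) rotations₆
  rotations-fix = toWitness {a? = allList? (λ w → isPerm? w ×-dec sgn? w 0ℙ ×-dec
    (w ! 0F ≟ 0F) ×-dec (w ! 1F ≟ 1F) ×-dec (w ! 2F ≟ 2F)) rotations₆} tt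

  -- The even derangements of {0,1,2} leave an odd permutation of {3,4,5} odd.
  odd-completions : All OnlyOddCompletions oddTriples
  odd-completions = toWitness {a? = allList? (λ (d , e , f) →
    all? λ a → ¬? (a ≟ 0F) →-dec ¬? (a ≟ d) →-dec ¬? (a ≟ e) →-dec ¬? (a ≟ f) →-dec
    all? λ b → ¬? (b ≟ 1F) →-dec ¬? (b ≟ a) →-dec ¬? (b ≟ d) →-dec ¬? (b ≟ e) →-dec ¬? (b ≟ f) →-dec
    all? λ c → ¬? (c ≟ 2F) →-dec ¬? (c ≟ a) →-dec ¬? (c ≟ b) →-dec ¬? (c ≟ d) →-dec ¬? (c ≟ e) →-dec ¬? (c ≟ f) →-dec
    sgn? (a ∷ b ∷ c ∷ d ∷ e ∷ f ∷ []) 1ℙ) oddTriples} tt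

-- Evenness of the avoided permutation excludes the case in which every rotation is spoiled.
fixing₃-base : ∀ {a b c d e f} → Alt (a ∷ b ∷ c ∷ d ∷ e ∷ f ∷ []) → a ≢ 0F → b ≢ 1F → c ≢ 2F →
  FixingAvoider (a ∷ b ∷ c ∷ d ∷ e ∷ f ∷ []) (0F L.∷ 1F L.∷ 2F L.∷ L.[])
fixing₃-base {a} {b} {c} {d} {e} {f} (alt p ev) a≢0 b≢1 c≢2 =
  [ by-rotation , ⊥-elim ∘ odd-case ]′ (rotation-or-odd d e (ne 3F 4F λ ()) f (ne 3F 5F λ ()) (ne 4F 5F λ ()))
  where
  ne : ∀ i j → i ≢ j → (a ∷ b ∷ c ∷ d ∷ e ∷ f ∷ []) ! i ≢ (a ∷ b ∷ c ∷ d ∷ e ∷ f ∷ []) ! j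
  ne i j i≢j eq = i≢j (p .injective i j eq)
  by-rotation : RotationAvoiding d e f → FixingAvoider (a ∷ b ∷ c ∷ d ∷ e ∷ f ∷ []) (0F L.∷ 1F L.∷ 2F L.∷ L.[])
  by-rotation avoiding =
    let (pw , ew , w₀ , w₁ , w₂) , d≢ , e≢ , f≢ = lookupAny rotations-fix avoiding
    in _ , alt (perm pw) ew , w₀ ∷ w₁ ∷ w₂ ∷ [] , λ
      { 0F eq → a≢0 (trans eq w₀) ; 1F eq → b≢1 (trans eq w₁) ; 2F eq → c≢2 (trans eq w₂)
      ; 3F eq → d≢ eq ; 4F eq → e≢ eq ; 5F eq → f≢ eq }
  odd-case : Any (λ t → t ≡ (d , e , f)) oddTriples → ⊥
  odd-case odd with lookupAny odd-completions odd
  ... | completions , eq with trans (sym ev) (subst OnlyOddCompletions eq completions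
      a a≢0 (ne 0F 3F λ ()) (ne 0F 4F λ ()) (ne 0F 5F λ ())
      b b≢1 (ne 1F 0F λ ()) (ne 1F 3F λ ()) (ne 1F 4F λ ()) (ne 1F 5F λ ())
      c c≢2 (ne 2F 0F λ ()) (ne 2F 1F λ ()) (ne 2F 3F λ ()) (ne 2F 4F λ ()) (ne 2F 5F λ ()))
  ...   | ()

-- From size 7 on, at least four points remain after deleting three and a single avoider of either
-- sign exists. Size 6 leaves three points, where both derangements are even, hence the separate
-- base.
fixing₃ : ∀ k {U : PermV (6 ℕ.+ k)} → Alt U → U ! 0F ≢ 0F → U ! 1F ≢ 1F → U ! 2F ≢ 2F →
  FixingAvoider U (0F L.∷ 1F L.∷ 2F L.∷ L.[])
fixing₃ zero {_ ∷ _ ∷ _ ∷ _ ∷ _ ∷ _ ∷ []} aU U₀≢0 U₁≢1 U₂≢2 = fixing₃-base aU U₀≢0 U₁≢1 U₂≢2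
fixing₃ (suc k) {U} (alt pU _) U₀≢0 U₁≢1 U₂≢2 =
  let w , pw , ew , aw = single-avoider k (Perm-drop₁ (Perm-drop₁ (Perm-drop₁ pU))) 0ℙ
  in lift₁ (lift₁ (lift₁ w)) , Alt-lift₁ (Alt-lift₁ (Alt-lift₁ (alt pw ew))) , refl ∷ refl ∷ refl ∷ [] ,
     Avoid-lift₃ U w U₀≢0 U₁≢1 U₂≢2 aw

agree₃ : ∀ k {h v : PermV (6 ℕ.+ k)} → Alt h → Alt v → {a b c : Fin (6 ℕ.+ k)} → a ≢ b → a ≢ c → b ≢ c →
  h ! a ≢ v ! a → h ! b ≢ v ! b → h ! c ≢ v ! c →
  ∃ λ x → Alt x × x ! a ≡ h ! a × x ! b ≡ h ! b × x ! c ≡ h ! c × Avoid v x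
agree₃ k {h} {v} ah (alt pv ev) a≢b a≢c b≢c ha≢va hb≢vb hc≢vc =
  let L , pL , 0↦a , 1↦b , 2↦c = transporter₃ a≢b a≢c b≢c
      x , ax , agree , vx = agreeVia ah pv pL (0F L.∷ 1F L.∷ 2F L.∷ L.[])
        (subst (λ i → h ! i ≢ v ! i) (sym 0↦a) ha≢va ∷ subst (λ i → h ! i ≢ v ! i) (sym 1↦b) hb≢vb ∷
         subst (λ i → h ! i ≢ v ! i) (sym 2↦c) hc≢vc ∷ [])
        (λ { pU even (U₀≢0 ∷ U₁≢1 ∷ U₂≢2 ∷ []) → fixing₃ k (alt pU (even ev)) U₀≢0 U₁≢1 U₂≢2 })
  in x , ax , subst (λ i → x ! i ≡ h ! i) 0↦a (All-head agree) , subst (λ i → x ! i ≡ h ! i) 1↦b (All-head (All-tail agree)) ,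
     subst (λ i → x ! i ≡ h ! i) 2↦c (All-head (All-tail (All-tail agree))) , vx

-- Even 3-cycles.

module _ (a b c : Fin n) where

  private
    w : PermV n
    w = swap a c · swap a b

  -- The 3-cycle a ↦ b ↦ c ↦ a, written as a square so that it is visibly even.
  cycle₃ : PermV n
  cycle₃ = w · w

  Alt-cycle₃ : Alt cycle₃
  Alt-cycle₃ = alt (Perm-· pw pw) (trans (sgn-· pw pw) (⊕-self (sgn w)))
    where
    pw : Perm w
    pw = Perm-· (Perm-swap a c) (Perm-swap a b)

  module _ (a≢b : a ≢ b) (a≢c : a ≢ c) (b≢c : b ≢ c) where

    private
      steps : ∀ {i j k} → w ! i ≡ j → w ! j ≡ k → cycle₃ ! i ≡ k
      steps {i} wi wj = trans (lookup-· w w i) (trans (cong (w !_) wi) wj)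

      step : ∀ {i j k} → swap a c ! i ≡ j → swap a b ! j ≡ k → w ! i ≡ k
      step {i} si sj = trans (lookup-· (swap a c) (swap a b) i) (trans (cong (swap a b !_) si) sj)

      w-a : w ! a ≡ c
      w-a = step (swap-left a c) (swap-other (a≢c ∘ sym) (b≢c ∘ sym))

      w-c : w ! c ≡ b
      w-c = step (swap-right a c) (swap-left a b)

    cycle₃-a : cycle₃ ! a ≡ b
    cycle₃-a = steps w-a w-c

    cycle₃-other : ∀ {i} → i ≢ a → i ≢ b → i ≢ c → cycle₃ ! i ≡ i
    cycle₃-other i≢a i≢b i≢c = steps w-i w-i
      where w-i = step (swap-other i≢a i≢c) (swap-other i≢a i≢b)

-- Stars inside independent co-dominating sets: the case n ≥ 6.

Searchable : Set → Set₁
Searchable A = {P : A → Set} → (∀ a → Dec (P a)) → Dec (∃ P)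

-- All quantifiers range over finite types, so the classical steps, such as extracting a witness
-- from a failed universal statement, reduce to exhaustive search.
search-Vec : Searchable A → ∀ m → Searchable (Vec A m)
search-Vec s zero    P? = map′ ([] ,_) (λ { ([] , p) → p }) (P? [])
search-Vec s (suc m) P? = map′ (λ (x , xs , p) → x ∷ xs , p) (λ { (x ∷ xs , p) → x , xs , p })
  (s λ x → search-Vec s m λ xs → P? (x ∷ xs))

alt? : (σ : PermV n) → Dec (Alt σ)
alt? σ = map′ (λ (p , e) → alt (perm p) e) (λ (alt p e) → p .injective , e) (isPerm? σ ×-dec sgn? σ 0ℙ)

Independent : (PermV n → Set) → Set
Independent H = ∀ {u w} → Alt u → Alt w → H u → H w → ¬ Avoid u w

CoDominating : (PermV n → Set) → Set
CoDominating H = ∀ {x y} → Alt x → Alt y → ¬ H x → ¬ H y → ∃ λ v → Alt v × H v × Avoid x v × Avoid y v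

ContainsStar : (PermV n → Set) → Set
ContainsStar H = ∃₂ λ i j → ∀ u → Alt u → u ! i ≡ j → H u

containsStar? : {H : PermV n → Set} → (∀ u → Dec (H u)) →
  ContainsStar H ⊎ (∀ i j → ∃ λ u → Alt u × u ! i ≡ j × ¬ H u)
containsStar? {n} {H} H? with any? (λ i → any? (λ j → ¬? (search-Vec any? n (λ u → alt? u ×-dec (u ! i ≟ j) ×-dec ¬? (H? u)))))
... | yes (i , j , none) = inj₁ (i , j , λ u au uᵢ → decidable-stable (H? u) λ ¬Hu → none (u , au , uᵢ , ¬Hu))
... | no ¬star = inj₂ λ i j → decidable-stable (search-Vec any? n λ u → alt? u ×-dec (u ! i ≟ j) ×-dec ¬? (H? u))
                   λ none → ¬star (i , j , none)

module Large (k : ℕ) {H : PermV (6 ℕ.+ k) → Set} (H? : ∀ u → Dec (H u))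
  (indep : Independent H) (dom : CoDominating H)
  (bad₁ : ∀ i j → ∃ λ u → Alt u × u ! i ≡ j × ¬ H u) where

  private
    N : ℕ
    N = 6 ℕ.+ k

  -- Take x and y outside H agreeing with h at `a` and at `b` respectively. Their common neighbour v
  -- in H differs from h at both points, so some z agrees with h at both and avoids v; independence
  -- keeps z out of H.
  bad₂ : ∀ {h} → Alt h → ∀ {a b} → a ≢ b → ∃ λ x → Alt x × ¬ H x × x ! a ≡ h ! a × x ! b ≡ h ! b
  bad₂ {h} ah {a} {b} a≢b =
    let x , ax , xa , ¬Hx = bad₁ a (h ! a)
        y , ay , yb , ¬Hy = bad₁ b (h ! b)
        v , av , Hv , xv , yv = dom ax ay ¬Hx ¬Hy
        z , az , za , zb , vz = agree₂ k ah (av .isPerm) a≢b (λ eq → xv a (trans xa eq)) (λ eq → yv b (trans yb eq))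
    in z , az , (λ Hz → indep av az Hv Hz vz) , za , zb

  bad₃ : ∀ {h} → Alt h → ∀ {a b c} → a ≢ b → a ≢ c → b ≢ c →
    ∃ λ x → Alt x × ¬ H x × x ! a ≡ h ! a × x ! b ≡ h ! b × x ! c ≡ h ! c
  bad₃ {h} ah {a} {b} {c} a≢b a≢c b≢c =
    let x , ax , ¬Hx , xa , xb = bad₂ ah a≢b
        y , ay , yc , ¬Hy = bad₁ c (h ! c)
        v , av , Hv , xv , yv = dom ax ay ¬Hx ¬Hy
        z , az , za , zb , zc , vz = agree₃ k ah av a≢b a≢c b≢c (λ eq → xv a (trans xa eq)) (λ eq → xv b (trans xb eq))
                                       (λ eq → yv c (trans yc eq))
    in z , az , (λ Hz → indep av az Hv Hz vz) , za , zb , zc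

  -- If z = (3-cycle) h were outside H, then z and some y ∉ H agreeing with h on the cycle would together cover h.
  closed : ∀ {h} → Alt h → H h → ∀ {a b c} → a ≢ b → a ≢ c → b ≢ c → H (cycle₃ a b c · h)
  closed {h} ah Hh {a} {b} {c} a≢b a≢c b≢c = decidable-stable (H? _) λ ¬Hz →
    let y , ay , ¬Hy , ya , yb , yc = bad₃ ah a≢b a≢c b≢c
        v , av , Hv , zv , yv = dom (Alt-· (Alt-cycle₃ a b c) ah) ay ¬Hz ¬Hy
    in indep ah av Hh Hv (covers v y zv yv ya yb yc)
    where
    covers : ∀ v y → Avoid (cycle₃ a b c · h) v → Avoid y v →
      y ! a ≡ h ! a → y ! b ≡ h ! b → y ! c ≡ h ! c → Avoid h v
    covers v y zv yv ya yb yc i eq with i ≟ a | i ≟ b | i ≟ c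
    ... | yes refl | _        | _        = yv i (trans ya eq)
    ... | no _     | yes refl | _        = yv i (trans yb eq)
    ... | no _     | no _     | yes refl = yv i (trans yc eq)
    ... | no i≢a   | no i≢b   | no i≢c   = zv i (trans (lookup-· (cycle₃ a b c) h i)
      (trans (cong (h !_) (cycle₃-other a b c a≢b a≢c b≢c i≢a i≢b i≢c)) eq))

  nonempty : ∃ λ h → Alt h × H h
  nonempty with H? ι
  ... | yes Hι = ι , Alt-ι , Hι
  ... | no ¬Hι = let v , av , Hv , _ = dom Alt-ι Alt-ι ¬Hι ¬Hι in v , av , Hv

  -- The points 0 and 1 are scratch space: no image is prescribed there, so a 3-cycle may use one of
  -- them as its third point without spoiling what has been arranged.
  spare : (b d : Fin N) → b ≢ d → d ≢ 0F → d ≢ 1F → ∃ λ c → c ≢ b × c ≢ d × (c ≡ 0F ⊎ c ≡ 1F)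
  spare zero    d b≢d d≢0 d≢1 = 1F , (λ ()) , d≢1 ∘ sym , inj₂ refl
  spare (suc b) d b≢d d≢0 d≢1 = 0F , (λ ()) , d≢0 ∘ sym , inj₁ refl

  -- Sorting by 3-cycles: `b` carries the image wanted at `d`, and the cycle on `d`, `b` and a
  -- scratch point brings it there. Points already arranged stay put: they are neither `d`, whose
  -- image was wrong, nor `b`, whose image belongs to `d`.
  reach : ∀ {X} → Perm X → (ds : L.List (Fin N)) → All (λ d → d ≢ 0F × d ≢ 1F) ds →
    ∃ λ h → Alt h × H h × All (λ d → h ! d ≡ X ! d) ds
  reach pX L.[] [] = let h , ah , Hh = nonempty in h , ah , Hh , []
  reach {X} pX (d L.∷ ds) ((d≢0 , d≢1) ∷ all) with reach pX ds all
  ... | h , ah , Hh , agree with h ! d ≟ X ! d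
  ...   | yes hd = h , ah , Hh , hd ∷ agree
  ...   | no hd≢Xd with injective⇒surjective (h !_) (ah .isPerm .injective) (X ! d)
  ...     | b , hb with spare b d (λ { refl → hd≢Xd hb }) d≢0 d≢1
  ...       | c , c≢b , c≢d , c∈ =
    cycle₃ d b c · h , Alt-· (Alt-cycle₃ d b c) ah , closed ah Hh d≢b (c≢d ∘ sym) (c≢b ∘ sym) ,
    trans (lookup-· (cycle₃ d b c) h d) (trans (cong (h !_) (cycle₃-a d b c d≢b (c≢d ∘ sym) (c≢b ∘ sym))) hb) ∷
    keep all agree
    where
    d≢b : d ≢ b
    d≢b refl = hd≢Xd hb
    c-scratch : ∀ {i} → i ≢ 0F → i ≢ 1F → i ≢ c
    c-scratch i≢0 i≢1 i≡c = [ (λ c≡0 → i≢0 (trans i≡c c≡0)) , (λ c≡1 → i≢1 (trans i≡c c≡1)) ]′ c∈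
    keep : ∀ {is} → All (λ i → i ≢ 0F × i ≢ 1F) is → All (λ i → h ! i ≡ X ! i) is →
      All (λ i → (cycle₃ d b c · h) ! i ≡ X ! i) is
    keep [] [] = []
    keep (_∷_ {x = i} (i≢0 , i≢1) all) (hi ∷ agree) =
      trans (lookup-· (cycle₃ d b c) h i) (trans (cong (h !_) (cycle₃-other d b c d≢b (c≢d ∘ sym) (c≢b ∘ sym)
        (λ { refl → hd≢Xd hi })
        (λ { refl → d≢b (pX .injective _ _ (trans (sym hb) hi)) })
        (c-scratch i≢0 i≢1))) hi)
      ∷ keep all agree

  -- `h` agrees with `X` outside {0, 1}, so it could differ from `X` only by exchanging two images.
  -- As `X` avoids `h₀` and also `h₀` with the images of 0 and 1 exchanged, `h` avoids `h₀` either
  -- way, although both lie in H.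
  absurd : ⊥
  absurd =
    let h₀ , ah₀ , Hh₀ = nonempty
        X , pX , _ , avoid , avoid′ = avoider (suc k) (ah₀ .isPerm) (Perm-· (Perm-swap 0F 1F) (ah₀ .isPerm)) 0ℙ
        h , ah , Hh , agree = reach pX (L.tabulate (λ i → suc (suc i))) (tabulate⁺ {f = λ i → suc (suc i)} λ i → (λ ()) , λ ())
    in indep ah₀ ah Hh₀ Hh (disjoint h₀ X h pX (ah .isPerm) avoid avoid′ (tabulate⁻ agree))
    where
    disjoint : ∀ h₀ X h → Perm X → Perm h → Avoid h₀ X → Avoid (swap 0F 1F · h₀) X →
      (∀ i → h ! suc (suc i) ≡ X ! suc (suc i)) → Avoid h₀ h
    disjoint h₀ X h pX ph avoid avoid′ agree (suc (suc i)) eq = avoid (suc (suc i)) (trans eq (agree i))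
    disjoint h₀ X h pX ph avoid avoid′ agree zero eq with injective⇒surjective (X !_) (pX .injective) (h ! zero)
    ... | zero , X₀ = avoid zero (trans eq (sym X₀))
    ... | suc zero , X₁ = avoid′ 1F (trans (lookup-· (swap 0F 1F) h₀ 1F)
                            (trans (cong (h₀ !_) (swap-right 0F 1F)) (trans eq (sym X₁))))
    ... | suc (suc s) , Xₛ with () ← ph .injective _ _ (trans (agree s) Xₛ)
    disjoint h₀ X h pX ph avoid avoid′ agree (suc zero) eq with injective⇒surjective (X !_) (pX .injective) (h ! 1F)
    ... | zero , X₀ = avoid′ zero (trans (lookup-· (swap 0F 1F) h₀ zero)
                            (trans (cong (h₀ !_) (swap-left 0F 1F)) (trans eq (sym X₀))))
    ... | suc zero , X₁ = avoid 1F (trans eq (sym X₁))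
    ... | suc (suc s) , Xₛ with () ← ph .injective _ _ (trans (agree s) Xₛ)

star₆₊ : ∀ k {H : PermV (6 ℕ.+ k) → Set} → (∀ u → Dec (H u)) → Independent H → CoDominating H → ContainsStar H
star₆₊ k H? indep dom = [ id , (λ bad₁ → ⊥-elim (Large.absurd k H? indep dom bad₁)) ]′ (containsStar? H?)

-- Stars inside independent sets: the case n = 5.

MeetsCliques : (PermV n → Set) → Set
MeetsCliques {n} H = (K : Fin n → PermV n) → (∀ t → Alt (K t)) → (∀ s t → s ≢ t → Avoid (K s) (K t)) → ∃ λ t → H (K t)

-- The cosets of the 5-cycle; representatives are the even permutations fixing 4.
translate : PermV 5 → Fin 5 → PermV 5
translate g t = Vec.map (λ j → (toℕ j ℕ.+ toℕ t) mod 5) g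

reps : L.List (PermV 5)
reps = L.map (Vec.map (_mod 5))
  ( (0 ∷ 1 ∷ 2 ∷ 3 ∷ 4 ∷ []) L.∷ (0 ∷ 2 ∷ 3 ∷ 1 ∷ 4 ∷ []) L.∷ (0 ∷ 3 ∷ 1 ∷ 2 ∷ 4 ∷ []) L.∷ (1 ∷ 0 ∷ 3 ∷ 2 ∷ 4 ∷ [])
  L.∷ (1 ∷ 2 ∷ 0 ∷ 3 ∷ 4 ∷ []) L.∷ (1 ∷ 3 ∷ 2 ∷ 0 ∷ 4 ∷ []) L.∷ (2 ∷ 0 ∷ 1 ∷ 3 ∷ 4 ∷ []) L.∷ (2 ∷ 1 ∷ 3 ∷ 0 ∷ 4 ∷ [])
  L.∷ (2 ∷ 3 ∷ 0 ∷ 1 ∷ 4 ∷ []) L.∷ (3 ∷ 0 ∷ 2 ∷ 1 ∷ 4 ∷ []) L.∷ (3 ∷ 1 ∷ 0 ∷ 2 ∷ 4 ∷ []) L.∷ (3 ∷ 2 ∷ 1 ∷ 0 ∷ 4 ∷ []) L.∷ L.[])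

avoid? : (σ τ : PermV n) → Dec (Avoid σ τ)
avoid? σ τ = all? λ i → ¬? (σ ! i ≟ τ ! i)

-- T is a choice of one element from each coset already treated.
Outcome : L.List (PermV 5) → L.List (PermV 5) → Set
Outcome L.[]       T = ∃₂ λ i j → All (λ u → u ! i ≡ j) T
Outcome (g L.∷ gs) T = ∀ t → Any (λ u → Avoid u (translate g t)) T ⊎ Outcome gs (translate g t L.∷ T)

outcome? : ∀ gs T → Dec (Outcome gs T)
outcome? L.[]       T = any? λ i → any? λ j → allList? (λ u → u ! i ≟ j) T
outcome? (g L.∷ gs) T = all? λ t → anyList? (λ u → avoid? u (translate g t)) T ⊎-dec outcome? gs (translate g t L.∷ T)

-- A pairwise non-adjacent choice from the twelve cosets has a cell common to all its members. The
-- tree branches over the five elements of each coset and is cut at the first adjacent pair, far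
-- short of all choices.
all-outcomes : Outcome reps L.[]
all-outcomes = toWitness {a? = outcome? reps L.[]} tt

opaque
  unfolding sgn sgn?

  translates-even : All (λ g → ∀ t → IsPerm (translate g t) × sgn (translate g t) ≡ 0ℙ) reps
  translates-even = toWitness {a? = allList? (λ g → all? λ t → isPerm? (translate g t) ×-dec sgn? (translate g t) 0ℙ) reps} tt

  translates-exhaust : (a b : Fin 5) → b ≢ a → (c : Fin 5) → c ≢ a → c ≢ b →
    (d : Fin 5) → d ≢ a → d ≢ b → d ≢ c → (e : Fin 5) → e ≢ a → e ≢ b → e ≢ c → e ≢ d →
    sgn (a ∷ b ∷ c ∷ d ∷ e ∷ []) ≡ 0ℙ → Any (λ g → ∃ λ t → translate g t ≡ a ∷ b ∷ c ∷ d ∷ e ∷ []) reps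
  translates-exhaust = toWitness {a? = all? λ a → all? λ b → ¬? (b ≟ a) →-dec all? λ c → ¬? (c ≟ a) →-dec ¬? (c ≟ b) →-dec
    all? λ d → ¬? (d ≟ a) →-dec ¬? (d ≟ b) →-dec ¬? (d ≟ c) →-dec
    all? λ e → ¬? (e ≟ a) →-dec ¬? (e ≟ b) →-dec ¬? (e ≟ c) →-dec ¬? (e ≟ d) →-dec
    sgn? (a ∷ b ∷ c ∷ d ∷ e ∷ []) 0ℙ →-dec
    anyList? (λ g → any? λ t → ≡-dec _≟_ (translate g t) (a ∷ b ∷ c ∷ d ∷ e ∷ [])) reps} tt

translates-disjoint : All (λ g → ∀ s t → s ≢ t → Avoid (translate g s) (translate g t)) reps
translates-disjoint =
  toWitness {a? = allList? (λ g → all? λ s → all? λ t → ¬? (s ≟ t) →-dec avoid? (translate g s) (translate g t)) reps} tt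

Representatives : L.List (PermV 5) → Set
Representatives = All λ g → (∀ t → Alt (translate g t)) × (∀ s t → s ≢ t → Avoid (translate g s) (translate g t))

good-reps : Representatives reps
good-reps = All-zip (All-map (λ even t → alt (perm (even t .proj₁)) (even t .proj₂)) translates-even , translates-disjoint)

Exhausted : L.List (PermV 5) → Set
Exhausted gs = ∀ u → Alt u → Any (λ g → ∃ λ t → translate g t ≡ u) gs

reps-exhaust : Exhausted reps
reps-exhaust (a ∷ b ∷ c ∷ d ∷ e ∷ []) (alt p ev) = translates-exhaust a
  b (ne 1F 0F λ ()) c (ne 2F 0F λ ()) (ne 2F 1F λ ())
  d (ne 3F 0F λ ()) (ne 3F 1F λ ()) (ne 3F 2F λ ())
  e (ne 4F 0F λ ()) (ne 4F 1F λ ()) (ne 4F 2F λ ()) (ne 4F 3F λ ()) ev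
  where
  ne : ∀ i j → i ≢ j → (a ∷ b ∷ c ∷ d ∷ e ∷ []) ! i ≢ (a ∷ b ∷ c ∷ d ∷ e ∷ []) ! j
  ne i j i≢j eq = i≢j (p .injective i j eq)

module _ {H : PermV 5 → Set} (indep : Independent H) (meets : MeetsCliques H) where

  -- Descends the search tree along H: `meets` selects the branch at each coset, and a clash with an
  -- earlier choice would contradict independence.
  follow : ∀ gs T → Representatives gs → All Alt T → All H T → Outcome gs T → ∃₂ λ i j →
    All (λ u → u ! i ≡ j) T × All (λ g → ∃ λ t → H (translate g t) × translate g t ! i ≡ j) gs
  follow L.[]       T []                  aT HT (i , j , Tij) = i , j , Tij , []
  follow (g L.∷ gs) T ((alts , clique) ∷ good) aT HT outcome with meets (translate g) alts clique
  ... | t , Ht with outcome t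
  ...   | inj₁ clash = let (au , Hu) , av = lookupAny (All-zip (aT , HT)) clash in ⊥-elim (indep au (alts t) Hu Ht av)
  ...   | inj₂ rest with follow gs (translate g t L.∷ T) good (alts t ∷ aT) (Ht ∷ HT) rest
  ...     | i , j , tij ∷ Tij , found = i , j , Tij , (t , Ht , tij) ∷ found

  -- Elements of one coset have different images at `i`. So a vertex `u` sending `i` to `j` equals
  -- the chosen element of its coset, which lies in H.
  starVia : ∀ gs → Representatives gs → Exhausted gs → Outcome gs L.[] → ContainsStar H
  starVia gs good exhaust outcome with follow gs L.[] good [] [] outcome
  ... | i , j , _ , found = i , j , inside
    where
    inside : ∀ u → Alt u → u ! i ≡ j → H u
    inside u au uᵢ with lookupAny (All-zip (found , good)) (exhaust u au)
    ... | ((t , Ht , tᵢ) , _ , disjoint) , (s , eq) with s ≟ t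
    ...   | yes refl = subst H eq Ht
    ...   | no s≢t   = ⊥-elim (disjoint s t s≢t i (trans (cong (_! i) eq) (trans uᵢ (sym tᵢ))))

star₅ : {H : PermV 5 → Set} → Independent H → MeetsCliques H → ContainsStar H
star₅ indep meets = starVia indep meets reps good-reps reps-exhaust all-outcomes

star : 5 ≤ n → {H : PermV n → Set} → (∀ u → Dec (H u)) → Independent H → CoDominating H → MeetsCliques H → ContainsStar H
star (s≤s (s≤s (s≤s (s≤s (s≤s (z≤n {zero})))))) H? indep dom meets = star₅ indep meets
star (s≤s (s≤s (s≤s (s≤s (s≤s (z≤n {suc k})))))) H? indep dom meets = star₆₊ k H? indep dom

commonAvoider : 5 ≤ n → CommonAvoider n
commonAvoider (s≤s (s≤s (s≤s (s≤s (s≤s (z≤n {k})))))) = avoider k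

commonAvoiderThrough : 5 ≤ n → CommonAvoiderThrough n
commonAvoiderThrough (s≤s (s≤s (s≤s (s≤s (s≤s (z≤n {k})))))) = throughAll k

-- Vertices of the power graph, and reduction to one coordinate.

record Vertex (x : V n q) : Set where
  constructor vertex
  field coord : ∀ k → Alt (x ! k)
open Vertex

IsVertex⇒Vertex : (x : V n q) → IsVertex x → Vertex x
IsVertex⇒Vertex x vx = vertex λ k → InA⇒Alt (vx k)

Vertex⇒IsVertex : {x : V n q} → Vertex x → IsVertex x
Vertex⇒IsVertex vx k = Alt⇒InA (vx .coord k)

Vertex-tabulate : {f : Fin q → PermV n} → (∀ k → Alt (f k)) → Vertex (tabulate f)
Vertex-tabulate {f = f} af = vertex λ k → subst Alt (sym (lookup∘tabulate f k)) (af k)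

vertex? : (x : V n q) → Dec (Vertex x)
vertex? x = map′ vertex coord (all? λ k → alt? (x ! k))

search-V : Searchable (V n q)
search-V {n} {q} = search-Vec (search-Vec any? n) q

_≟ₚ_ : (σ τ : PermV n) → Dec (σ ≡ τ)
_≟ₚ_ = ≡-dec _≟_

neighbour : 5 ≤ n → {u : PermV n} → Alt u → ∃ λ v → Alt v × Avoid u v
neighbour n≥5 au = let v , pv , ev , uv , _ = commonAvoider n≥5 (au .isPerm) (au .isPerm) 0ℙ in v , alt pv ev , uv

VIndependent : (V n q → Set) → Set
VIndependent H = ∀ {x y} → Vertex x → Vertex y → H x → H y → ¬ Adj x y

VCoDominating : (V n q → Set) → Set
VCoDominating H = ∀ {x y} → Vertex x → Vertex y → ¬ H x → ¬ H y → ∃ λ v → Vertex v × H v × Adj x v × Adj y v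

VMeetsCliques : (V n q → Set) → Set
VMeetsCliques {n} {q} H = (K : Fin n → V n q) → (∀ t → Vertex (K t)) → (∀ s t → s ≢ t → Adj (K s) (K t)) → ∃ λ t → H (K t)

module Glue {n q : ℕ} {P : Fin q → Set} (P? : ∀ j → Dec (P j)) where

  glue : V n q → V n q → V n q
  glue x y = tabulate λ j → if does (P? j) then x ! j else y ! j

  glue-yes : ∀ x y {j} → P j → glue x y ! j ≡ x ! j
  glue-yes x y {j} p = trans (lookup∘tabulate _ j) (cong (λ b → if b then x ! j else y ! j) (dec-true (P? j) p))

  glue-no : ∀ x y {j} → ¬ P j → glue x y ! j ≡ y ! j
  glue-no x y {j} ¬p = trans (lookup∘tabulate _ j) (cong (λ b → if b then x ! j else y ! j) (dec-false (P? j) ¬p))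

  Vertex-glue : ∀ {x y} → Vertex x → Vertex y → Vertex (glue x y)
  Vertex-glue {x} {y} vx vy .coord j with P? j
  ... | yes p = subst Alt (sym (glue-yes x y p)) (vx .coord j)
  ... | no ¬p = subst Alt (sym (glue-no x y ¬p)) (vy .coord j)

  Adj-glue : ∀ z x y → (∀ j → P j → Avoid (z ! j) (x ! j)) → Adj z y → Adj z (glue x y)
  Adj-glue z x y zx zy j with P? j
  ... | yes p = subst (Avoid (z ! j)) (sym (glue-yes x y p)) (zx j p)
  ... | no ¬p = subst (Avoid (z ! j)) (sym (glue-no x y ¬p)) (zy j)

module Reduction (n≥5 : 5 ≤ n) {H : V n q → Set} (H? : ∀ x → Dec (H x))
  (indep : VIndependent H) (dom : VCoDominating H) (meets : VMeetsCliques H) where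

  Fibre : V n q → Fin q → Set
  Fibre h k = ∀ x → Vertex x → x ! k ≡ h ! k → H x

  opposite : ∀ {x} → Vertex x → ∃ λ y → Vertex y × Adj x y
  opposite {x} vx = tabulate opp , Vertex-tabulate (λ j → neighbour n≥5 (vx .coord j) .proj₂ .proj₁) ,
    λ j i eq → neighbour n≥5 (vx .coord j) .proj₂ .proj₂ i (trans eq (cong (_! i) (lookup∘tabulate opp j)))
    where
    opp : Fin q → PermV n
    opp j = neighbour n≥5 (vx .coord j) .proj₁

  module _ {h : V n q} (vh : Vertex h) (Hh : H h)
    (escape : ∀ k → ∃ λ x → Vertex x × x ! k ≡ h ! k × ¬ H x) where

    -- The argument of `bad₂` with coordinates in place of points. The common neighbour v of x and y
    -- is adjacent to h in the listed coordinates; h there, glued to a neighbour of v elsewhere, is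
    -- adjacent to v and so outside H. For the full list this vertex is h itself.
    escape-all : (ks : L.List (Fin q)) → ∃ λ x → Vertex x × ¬ H x × (∀ {j} → j ∈ ks → x ! j ≡ h ! j)
    escape-all L.[] = let x , vx , hx = opposite vh in x , vx , (λ Hx → indep vh vx Hh Hx hx) , λ ()
    escape-all (k L.∷ ks) =
      let x , vx , ¬Hx , xh = escape-all ks
          y , vy , yh , ¬Hy = escape k
          v , vv , Hv , xv , yv = dom vx vy ¬Hx ¬Hy
          z , vz , vz-adj = opposite vv
      in glue h z , Vertex-glue vh vz ,
         (λ Hg → indep vv (Vertex-glue vh vz) Hv Hg (Adj-glue v h z (λ j j∈ i eq → avoids x y v xh yh xv yv j∈ i (sym eq)) vz-adj)) ,
         glue-yes h z
      where
      open Glue (λ j → anyList? (j ≟_) (k L.∷ ks))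
      avoids : ∀ x y v → (∀ {j} → j ∈ ks → x ! j ≡ h ! j) → y ! k ≡ h ! k → Adj x v → Adj y v →
        ∀ {j} → j ∈ (k L.∷ ks) → Avoid (h ! j) (v ! j)
      avoids x y v xh yh xv yv (here refl) i = subst (λ u → u ! i ≢ v ! k ! i) yh (yv k i)
      avoids x y v xh yh xv yv {j} (there j∈) i = subst (λ u → u ! i ≢ v ! j ! i) (xh j∈) (xv j i)

    no-escape : ⊥
    no-escape = let x , vx , ¬Hx , xh = escape-all (L.allFin q) in
      ¬Hx (subst H (vec-ext λ j → sym (xh (∈-allFin j))) Hh)

  fibre? : ∀ h k → Dec (Fibre h k)
  fibre? h k with search-V (λ x → vertex? x ×-dec (x ! k ≟ₚ h ! k) ×-dec ¬? (H? x))
  ... | yes (x , vx , xh , ¬Hx) = no λ fib → ¬Hx (fib x vx xh)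
  ... | no none = yes λ x vx xh → decidable-stable (H? x) λ ¬Hx → none (x , vx , xh , ¬Hx)

  fibre : ∀ {h} → Vertex h → H h → ∃ λ k → Fibre h k
  fibre {h} vh Hh = decidable-stable (any? (fibre? h)) λ none → no-escape vh Hh λ k →
    decidable-stable (search-V λ x → vertex? x ×-dec (x ! k ≟ₚ h ! k) ×-dec ¬? (H? x)) λ none′ →
      none (k , λ x vx xh → decidable-stable (H? x) λ ¬Hx → none′ (x , vx , xh , ¬Hx))

  -- Fibres in different coordinates contain adjacent vertices: keep `h` at `k` and take a neighbour
  -- of `h′` elsewhere; then keep `h′` at `k′` and take a neighbour of the first vertex elsewhere.
  fibre-unique : ∀ h h′ {k k′} → Vertex h → Vertex h′ → Fibre h k → Fibre h′ k′ → k ≡ k′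
  fibre-unique h h′ {k} {k′} vh vh′ fib fib′ with k ≟ k′
  ... | yes k≡k′ = k≡k′
  ... | no k≢k′ with opposite vh′
  ...   | o , vo , h′o with opposite (Glue.Vertex-glue (_≟ k) vh vo)
  ...     | w , vw , gw = ⊥-elim (indep vg vg′
      (fib _ vg (glue-yes h o refl)) (fib′ _ vg′ (G.glue-yes h′ w refl))
      (G.Adj-glue (glue h o) h′ w (λ { j refl i eq → h′o j i (sym (trans (cong (_! i) (sym (glue-no h o (k≢k′ ∘ sym)))) eq)) }) gw))
    where
    open Glue (_≟ k)
    module G = Glue (_≟ k′)
    vg : Vertex (glue h o)
    vg = Vertex-glue vh vo
    vg′ : Vertex (G.glue h′ w)
    vg′ = G.Vertex-glue vh′ vw

  nonempty : Vertex {n} {q} (tabulate λ _ → ι) → ∃ λ h → Vertex h × H h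
  nonempty vι with H? (tabulate λ _ → ι)
  ... | yes Hι = _ , vι , Hι
  ... | no ¬Hι = let v , vv , Hv , _ = dom vι vι ¬Hι ¬Hι in v , vv , Hv

  -- By uniqueness every member of H has its full fibre in the same coordinate `k`, so membership is
  -- decided by that coordinate. The trace `H₀` inherits the three properties, and the result for
  -- one coordinate applies.
  star-V : ∃ λ k → ∃₂ λ i j → ∀ x → Vertex x → x ! k ! i ≡ j → H x
  star-V with nonempty (Vertex-tabulate λ _ → Alt-ι)
  ... | h , vh , Hh with fibre vh Hh
  ... | k , fib = let i , j , contained = star n≥5 (λ u → H? (h [ k ]≔ u)) indep₀ dom₀ meets₀
                  in k , i , j , λ x vx xᵢ → H₀⇒H vx (contained (x ! k) (vx .coord k) xᵢ)
    where
    H₀ : PermV n → Set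
    H₀ u = H (h [ k ]≔ u)
    Vertex-update : ∀ {u} → Alt u → Vertex (h [ k ]≔ u)
    Vertex-update {u} au .coord j with j ≟ k
    ... | yes refl = subst Alt (sym (lookup∘update k h u)) au
    ... | no j≢k   = subst Alt (sym (lookup∘update′ j≢k h u)) (vh .coord j)
    whole-fibre : ∀ x → Vertex x → H x → Fibre x k
    whole-fibre x vx Hx = let k′ , fib′ = fibre vx Hx in subst (Fibre x) (fibre-unique x h vx vh fib′ fib) fib′
    H⇒H₀ : ∀ {x} → Vertex x → H x → H₀ (x ! k)
    H⇒H₀ vx Hx = whole-fibre _ vx Hx _ (Vertex-update (vx .coord k)) (lookup∘update k h _)
    H₀⇒H : ∀ {x} → Vertex x → H₀ (x ! k) → H x
    H₀⇒H vx H₀x = whole-fibre _ (Vertex-update (vx .coord k)) H₀x _ vx (sym (lookup∘update k h _))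
    indep₀ : Independent H₀
    indep₀ {u} {w} au aw Hu Hw uw =
      let z , vz , hz = opposite (Vertex-update au)
          vg = Vertex-glue (Vertex-update aw) vz
      in indep (Vertex-update au) vg Hu
           (H₀⇒H vg (subst H₀ (sym (trans (glue-yes (h [ k ]≔ w) z refl) (lookup∘update k h w))) Hw))
           (Adj-glue (h [ k ]≔ u) (h [ k ]≔ w) z (λ { j refl → subst₂ Avoid (sym (lookup∘update k h u)) (sym (lookup∘update k h w)) uw }) hz)
      where open Glue (_≟ k)
    dom₀ : CoDominating H₀
    dom₀ {x} {y} ax ay ¬Hx ¬Hy =
      let v , vv , Hv , xv , yv = dom (Vertex-update ax) (Vertex-update ay) ¬Hx ¬Hy
      in v ! k , vv .coord k , H⇒H₀ vv Hv ,
         subst (λ u → Avoid u (v ! k)) (lookup∘update k h x) (xv k) ,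
         subst (λ u → Avoid u (v ! k)) (lookup∘update k h y) (yv k)
    meets₀ : MeetsCliques H₀
    meets₀ K aK clique =
      let t , Ht = meets (λ t → replicate q (K t)) (λ t → vertex λ j → subst Alt (sym (lookup-replicate j (K t))) (aK t))
                     (λ s t s≢t j → subst₂ Avoid (sym (lookup-replicate j (K s))) (sym (lookup-replicate j (K t))) (clique s t s≢t))
      in t , subst H₀ (lookup-replicate k (K t))
               (H⇒H₀ (vertex λ j → subst Alt (sym (lookup-replicate j (K t))) (aK t)) Ht)

-- Automorphisms and the images of stars.

record Auto (f g : V n q → V n q) : Set where
  field
    f-vertex : ∀ {x} → Vertex x → Vertex (f x)
    g-vertex : ∀ {x} → Vertex x → Vertex (g x)
    f∘g      : ∀ {x} → Vertex x → f (g x) ≡ x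
    g∘f      : ∀ {x} → Vertex x → g (f x) ≡ x
    f-adj    : ∀ {x y} → Vertex x → Vertex y → Adj x y → Adj (f x) (f y)
    g-adj    : ∀ {x y} → Vertex x → Vertex y → Adj x y → Adj (g x) (g y)

-- The inverse is part of the data so that whatever is proved for `f` can be applied to `g`.
Auto-sym : {f g : V n q → V n q} → Auto f g → Auto g f
Auto-sym a = record { f-vertex = g-vertex ; g-vertex = f-vertex ; f∘g = g∘f ; g∘f = f∘g ; f-adj = g-adj ; g-adj = f-adj }
  where open Auto a

IsAut⇒Auto : (f : V n q → V n q) → IsAut f → ∃ λ g → Auto f g
IsAut⇒Auto {n} {q} f (f-vert , f-inj , f-surj , f-adj⇔) = g , record
  { f-vertex = f-vertex
  ; g-vertex = λ vx → g-spec vx .proj₁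
  ; f∘g = λ vx → g-spec vx .proj₂
  ; g∘f = λ vx → let vfx = f-vertex vx in
      f-inj _ _ (Vertex⇒IsVertex (g-spec vfx .proj₁)) (Vertex⇒IsVertex vx) (g-spec vfx .proj₂)
  ; f-adj = λ vx vy → f-adj⇔ _ _ (Vertex⇒IsVertex vx) (Vertex⇒IsVertex vy) .proj₁
  ; g-adj = λ vx vy xy → f-adj⇔ _ _ (Vertex⇒IsVertex (g-spec vx .proj₁)) (Vertex⇒IsVertex (g-spec vy .proj₁)) .proj₂
      (subst₂ Adj (sym (g-spec vx .proj₂)) (sym (g-spec vy .proj₂)) xy)
  }
  where
  f-vertex : ∀ {x} → Vertex x → Vertex (f x)
  f-vertex {x} vx = IsVertex⇒Vertex (f x) (f-vert x (Vertex⇒IsVertex vx))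
  g : V n q → V n q
  g y with vertex? y
  ... | yes vy = f-surj y (Vertex⇒IsVertex vy) .proj₁
  ... | no _   = y
  g-spec : ∀ {y} → Vertex y → Vertex (g y) × f (g y) ≡ y
  g-spec {y} vy with vertex? y
  ... | yes vy′ = let x , vx , fx = f-surj y (Vertex⇒IsVertex vy′) in IsVertex⇒Vertex x vx , fx
  ... | no ¬vy  = ⊥-elim (¬vy vy)

Cell : ℕ → ℕ → Set
Cell n q = Fin q × Fin n × Fin n

infix 4 _∋_
_∋_ : V n q → Cell n q → Set
x ∋ (k , i , j) = x ! k ! i ≡ j

opaque
  -- `H` is the image of the star under `f`. A common neighbour in `H` of two vertices outside it is
  -- `f v`, with `v` chosen coordinate by coordinate to avoid their preimages and to pass through
  -- the cell in coordinate `k`.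
  starImage : 5 ≤ n → {f g : V n q → V n q} → Auto f g → (p : Cell n q) → ∃ λ p′ → ∀ x → Vertex x → x ∋ p′ → g x ∋ p
  starImage {n} {q} n≥5 {f} {g} auto (k , i , j) =
    let k′ , i′ , j′ , contained = Reduction.star-V n≥5 {H} (λ x → g x ! k ! i ≟ j) indep dom meets
    in (k′ , i′ , j′) , contained
    where
    open Auto auto
    H : V n q → Set
    H x = g x ! k ! i ≡ j
    indep : VIndependent H
    indep vx vy Hx Hy xy = g-adj vx vy xy k i (trans Hx (sym Hy))
    dom : VCoDominating H
    dom {x} {y} vx vy ¬Hx ¬Hy =
      f v , f-vertex vv , subst (λ z → z ! k ! i ≡ j) (sym (g∘f vv)) (coordinates k .proj₂ .proj₂ refl) ,
      subst (λ z → Adj z (f v)) (f∘g vx) (f-adj (g-vertex vx) vv λ m → coordinates m .proj₁) ,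
      subst (λ z → Adj z (f v)) (f∘g vy) (f-adj (g-vertex vy) vv λ m → coordinates m .proj₂ .proj₁)
      where
      choice : ∀ m → ∃ λ (u : PermV n) → Alt u × Avoid (g x ! m) u × Avoid (g y ! m) u × (m ≡ k → u ! i ≡ j)
      choice m with m ≟ k
      ... | yes refl = let u , pu , eu , uᵢ , xu , yu = commonAvoiderThrough n≥5 (g-vertex vx .coord m .isPerm)
                             (g-vertex vy .coord m .isPerm) i j ¬Hx ¬Hy 0ℙ
                       in u , alt pu eu , xu , yu , λ _ → uᵢ
      ... | no m≢k   = let u , pu , eu , xu , yu = commonAvoider n≥5 (g-vertex vx .coord m .isPerm) (g-vertex vy .coord m .isPerm) 0ℙ
                       in u , alt pu eu , xu , yu , λ m≡k → ⊥-elim (m≢k m≡k)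
      v : V n q
      v = tabulate λ m → choice m .proj₁
      coordinates : ∀ m → Avoid (g x ! m) (v ! m) × Avoid (g y ! m) (v ! m) × (m ≡ k → v ! m ! i ≡ j)
      coordinates m = subst (λ u → Avoid (g x ! m) u × Avoid (g y ! m) u × (m ≡ k → u ! i ≡ j)) (sym (lookup∘tabulate _ m)) (choice m .proj₂ .proj₂)
      vv : Vertex v
      vv = Vertex-tabulate λ m → choice m .proj₂ .proj₁
    meets : VMeetsCliques H
    -- The n members of the image clique have pairwise different images at `i`, so one of these is
    -- `j`.
    meets K vK clique = injective⇒surjective (λ t → g (K t) ! k ! i) inj j
      where
      inj : ∀ s t → g (K s) ! k ! i ≡ g (K t) ! k ! i → s ≡ t
      inj s t eq with s ≟ t
      ... | yes s≡t = s≡t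
      ... | no s≢t  = ⊥-elim (g-adj (vK s) (vK t) (clique s t s≢t) k i eq)

-- Inclusion and disjointness of stars, read off from their cells.

otherₙ : 5 ≤ n → (a b : Fin n) → ∃ λ c → c ≢ a × c ≢ b
otherₙ (s≤s (s≤s (s≤s _))) = other

module _ (n≥5 : 5 ≤ n) where

  -- It suffices to avoid, through the first cell, some z that contains the second cell and misses
  -- the first. Such a z sends `i` to a value `c` outside {j, j′} and then `i′` to `j′`; if `i` and
  -- `i′` coincide, `j` and `j′` differ.
  separate : ∀ {i j i′ j′ : Fin n} → (i ≡ i′ → j ≢ j′) → ∃ λ u → Alt u × u ! i ≡ j × u ! i′ ≢ j′
  separate {i} {j} {i′} {j′} ne with otherₙ n≥5 j j′
  ... | c , c≢j , c≢j′ = let u , pu , eu , uᵢ , zu , _ = commonAvoiderThrough n≥5 pz pz i j zᵢ≢j zᵢ≢j 0ℙ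
                         in u , alt pu eu , uᵢ , λ uᵢ′ → zu i′ (trans (lookup-aim p₁ i′ j′) (sym uᵢ′))
    where
    p₁ : Perm (aim (Perm-ι {n}) i c)
    p₁ = Perm-aim Perm-ι i c
    pz : Perm (aim p₁ i′ j′)
    pz = Perm-aim p₁ i′ j′
    i↦c : aim (Perm-ι {n}) i c ! i ≡ c
    i↦c = lookup-aim Perm-ι i c
    zᵢ≢j : aim p₁ i′ j′ ! i ≢ j
    zᵢ≢j eq with i ≟ i′
    ... | yes refl = ne refl (trans (sym eq) (lookup-aim p₁ i′ j′))
    ... | no i≢i′  = c≢j (trans (sym i↦c) (trans (sym (lookup-aim-other p₁ i′ j′ i≢i′ λ e → c≢j′ (trans (sym i↦c) e))) eq))

  through-cell : ∀ i j → ∃ λ (u : PermV n) → Alt u × u ! i ≡ j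
  through-cell i j = let c , c≢j , _ = otherₙ n≥5 j j
                         u , au , uᵢ , _ = separate {i} {j} {i} {c} (λ _ j≡c → c≢j (sym j≡c))
                     in u , au , uᵢ

  missing-cell : ∀ i j → ∃ λ (u : PermV n) → Alt u × u ! i ≢ j
  missing-cell i j = let c , c≢j , _ = otherₙ n≥5 j j
                         u , au , uᵢ = through-cell i c
                     in u , au , λ eq → c≢j (trans (sym uᵢ) eq)

fresh₃ : 5 ≤ n → {a b c : Fin n} → a ≢ b → a ≢ c → ∃ λ d → d ≢ a × d ≢ b × d ≢ c
fresh₃ (s≤s (s≤s (s≤s (s≤s _)))) {a} a≢b a≢c with other (punchOut a≢b) (punchOut a≢c)
... | d , d≢b , d≢c = punchIn a d , punchInᵢ≢i a d ,
  (λ eq → d≢b (punchIn-injective a _ _ (trans eq (sym (punchIn-punchOut a≢b))))) ,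
  (λ eq → d≢c (punchIn-injective a _ _ (trans eq (sym (punchIn-punchOut a≢c)))))

-- A permutation through the first cell is corrected at `i′` by a 3-cycle of values. Its third value
-- `d` is chosen different from `j`, so the first cell survives and the sign does not change.
through-cells : 5 ≤ n → {i j i′ j′ : Fin n} → i ≢ i′ → j ≢ j′ → ∃ λ u → Alt u × u ! i ≡ j × u ! i′ ≡ j′
through-cells n≥5 {i} {j} {i′} {j′} i≢i′ j≢j′ with through-cell n≥5 i j
... | u , au , uᵢ with u ! i′ ≟ j′
...   | yes uᵢ′ = u , au , uᵢ , uᵢ′
...   | no uᵢ′≢ with fresh₃ n≥5 {j′} {u ! i′} {j} (uᵢ′≢ ∘ sym) (j≢j′ ∘ sym)
...     | d , d≢j′ , d≢u , d≢j =
  u · z , Alt-· au (Alt-cycle₃ (u ! i′) j′ d) ,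
  trans (lookup-· u z i) (trans (cong (z !_) uᵢ) (cycle₃-other (u ! i′) j′ d uᵢ′≢ (d≢u ∘ sym) (d≢j′ ∘ sym)
    (λ j≡ → i≢i′ (au .isPerm .injective i i′ (trans uᵢ j≡))) j≢j′ (d≢j ∘ sym))) ,
  trans (lookup-· u z i′) (cycle₃-a (u ! i′) j′ d uᵢ′≢ (d≢u ∘ sym) (d≢j′ ∘ sym))
  where
  z = cycle₃ (u ! i′) j′ d

module _ {n q : ℕ} {k : Fin q} {u w : PermV n} where
  open Glue {n} (_≟ k)

  patch : V n q
  patch = glue (replicate q u) (replicate q w)

  patch-at : ∀ {m} → m ≡ k → patch ! m ≡ u
  patch-at {m} e = trans (glue-yes (replicate q u) (replicate q w) e) (lookup-replicate m u)

  patch-off : ∀ {m} → m ≢ k → patch ! m ≡ w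
  patch-off {m} ne = trans (glue-no (replicate q u) (replicate q w) ne) (lookup-replicate m w)

  Vertex-patch : Alt u → Alt w → Vertex patch
  Vertex-patch au aw = Vertex-glue {x = replicate q u} {replicate q w} (vertex λ m → subst Alt (sym (lookup-replicate m u)) au)
                                   (vertex λ m → subst Alt (sym (lookup-replicate m w)) aw)

-- Stars are pairwise incomparable; this upgrades the one-sided conclusion of `starImage` to
-- equalities.
⊆⇒≡ : 5 ≤ n → (p p′ : Cell n q) → (∀ x → Vertex x → x ∋ p → x ∋ p′) → p ≡ p′
⊆⇒≡ n≥5 (k , i , j) (k′ , i′ , j′) sub with k ≟ k′ | i ≟ i′ | j ≟ j′
... | no k≢k′ | _ | _ =
  let u , au , uᵢ = through-cell n≥5 i j
      w , aw , wᵢ′ = missing-cell n≥5 i′ j′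
  in ⊥-elim (wᵢ′ (trans (cong (_! i′) (sym (patch-off {k = k} {u} {w} (k≢k′ ∘ sym))))
       (sub patch (Vertex-patch au aw) (trans (cong (_! i) (patch-at {k = k} {u} {w} refl)) uᵢ))))
... | yes refl | yes refl | yes refl = refl
... | yes refl | no i≢i′ | _ = ⊥-elim (contra (separate n≥5 λ i≡i′ → ⊥-elim (i≢i′ i≡i′)))
  where
  contra : (∃ λ u → Alt u × u ! i ≡ j × u ! i′ ≢ j′) → ⊥
  contra (u , au , uᵢ , uᵢ′) = uᵢ′ (trans (cong (_! i′) (sym (patch-at {k = k} {u} {u} refl)))
    (sub patch (Vertex-patch au au) (trans (cong (_! i) (patch-at {k = k} {u} {u} refl)) uᵢ)))
... | yes refl | yes refl | no j≢j′ = ⊥-elim (contra (separate n≥5 λ _ → j≢j′))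
  where
  contra : (∃ λ u → Alt u × u ! i ≡ j × u ! i′ ≢ j′) → ⊥
  contra (u , au , uᵢ , uᵢ′) = uᵢ′ (trans (cong (_! i′) (sym (patch-at {k = k} {u} {u} refl)))
    (sub patch (Vertex-patch au au) (trans (cong (_! i) (patch-at {k = k} {u} {u} refl)) uᵢ)))

Conflict : Cell n q → Cell n q → Set
Conflict p p′ = ∀ x → Vertex x → x ∋ p → x ∋ p′ → ⊥

-- Otherwise some vertex contains both cells: one patched from two permutations if the coordinates
-- differ, one given by `through-cells` if they agree.
conflict⇒line : 5 ≤ n → {k k′ : Fin q} {i j i′ j′ : Fin n} → Conflict (k , i , j) (k′ , i′ , j′) → k ≡ k′ × (i ≡ i′ ⊎ j ≡ j′)
conflict⇒line n≥5 {k} {k′} {i} {j} {i′} {j′} c with k ≟ k′ | i ≟ i′ | j ≟ j′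
... | yes k≡k′ | yes i≡i′ | _ = k≡k′ , inj₁ i≡i′
... | yes k≡k′ | no _ | yes j≡j′ = k≡k′ , inj₂ j≡j′
... | yes refl | no i≢i′ | no j≢j′ =
  let u , au , uᵢ , uᵢ′ = through-cells n≥5 i≢i′ j≢j′
  in ⊥-elim (c patch (Vertex-patch au au) (trans (cong (_! i) (patch-at {k = k} {u} {u} refl)) uᵢ)
                                           (trans (cong (_! i′) (patch-at {k = k} {u} {u} refl)) uᵢ′))
... | no k≢k′ | _ | _ =
  let u , au , uᵢ = through-cell n≥5 i j
      w , aw , wᵢ′ = through-cell n≥5 i′ j′
  in ⊥-elim (c patch (Vertex-patch au aw) (trans (cong (_! i) (patch-at {k = k} {u} {w} refl)) uᵢ)
                                           (trans (cong (_! i′) (patch-off {k = k} {u} {w} (k≢k′ ∘ sym))) wᵢ′))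

-- Line-preserving injections of the square grid.

module _ {m : ℕ} (F G : Fin (2 ℕ.+ m) → Fin (2 ℕ.+ m) → Fin (2 ℕ.+ m))
  (inj : ∀ {i j i′ j′} → F i j ≡ F i′ j′ → G i j ≡ G i′ j′ → i ≡ i′ × j ≡ j′)
  (row : ∀ i j j′ → F i j ≡ F i j′ ⊎ G i j ≡ G i j′)
  (col : ∀ i i′ j → F i j ≡ F i′ j ⊎ G i j ≡ G i′ j) where

  -- A cell of row 0 with another F-value would share its G-value with (0, 0) and (0, 1), whose
  -- G-values differ. So row 0 maps bijectively onto a line, and a later cell sharing the F-value of
  -- that line would collide with row 0. This fixes the roles of F and G everywhere.
  rook-rows : F 0F 0F ≡ F 0F 1F → ∀ i j → F i j ≡ F i 0F × G i j ≡ G 0F j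
  rook-rows F₀₀≡F₀₁ i j = F-const , G-col i j
    where
    F₀ : ∀ j → F 0F j ≡ F 0F 0F
    F₀ j with row 0F j 0F | row 0F j 1F
    ... | inj₁ e | _      = e
    ... | inj₂ _ | inj₁ e = trans e (sym F₀₀≡F₀₁)
    ... | inj₂ e | inj₂ e′ with () ← inj F₀₀≡F₀₁ (trans (sym e) e′) .proj₂
    G₀-inj : ∀ j j′ → G 0F j ≡ G 0F j′ → j ≡ j′
    G₀-inj j j′ e = inj (trans (F₀ j) (sym (F₀ j′))) e .proj₂
    G-col : ∀ i j → G i j ≡ G 0F j
    G-col i j with col i 0F j
    ... | inj₂ e = e
    ... | inj₁ e with injective⇒surjective (G 0F) G₀-inj (G i j)
    ...   | j′ , e′ with inj (trans e (trans (F₀ j) (sym (F₀ j′)))) (sym e′)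
    ...     | refl , refl = refl
    F-const : F i j ≡ F i 0F
    F-const with row i j 0F
    ... | inj₁ e = e
    ... | inj₂ e = cong (F i) (G₀-inj j 0F (trans (sym (G-col i j)) (trans e (G-col i 0F))))

-- The elements of the group and their action on cells.

inv-intro : {σ : PermV n} → Perm σ → ∀ {i j} → σ ! i ≡ j → inv σ ! j ≡ i
inv-intro {σ = σ} pσ {i} refl = lookup-·-inv pσ i

inv-elim : {σ : PermV n} → Perm σ → ∀ {i j} → inv σ ! j ≡ i → σ ! i ≡ j
inv-elim {σ = σ} pσ {j = j} refl = lookup-inv-· pσ j

inv-inv : {σ : PermV n} → Perm σ → inv (inv σ) ≡ σ
inv-inv pσ = vec-ext λ i → inv-intro (Perm-inv pσ) (lookup-·-inv pσ i)

module Params {n q : ℕ} {g : V n q} {c : Vec (PermV n) q} {π : PermV q} (s : Vec Bool q)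
  (vg : Vertex g) (pc : ∀ k → Perm (c ! k)) (pπ : Perm π) where

  a b : Fin q → PermV n
  a k = inv (c ! k)
  b k = inv (g ! (π ! k) · c ! k)

  pa : ∀ k → Perm (a k)
  pa k = Perm-inv (pc k)

  pgc : ∀ k → Perm (g ! (π ! k) · c ! k)
  pgc k = Perm-· (vg .coord (π ! k) .isPerm) (pc k)

  -- The contravariant action: `E x` contains p exactly when `x` contains `Ψ p`. Rows are relabelled
  -- by conjugation alone, columns by conjugation and translation, and inverting a coordinate
  -- transposes its cells.
  Ψ : Cell n q → Cell n q
  Ψ (k , i , j) = if s ! k then (π ! k , a k ! j , b k ! i) else (π ! k , a k ! i , b k ! j)

  E : V n q → V n q
  E = Elt g c π s

  W : V n q → Fin q → PermV n
  W x k = conj (c ! k) (x ! (π ! k) · g ! (π ! k))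

  Vertex-W : ∀ {x} → Vertex x → ∀ k → Alt (W x k)
  Vertex-W vx k = Alt-conj (pc k) (Alt-· (vx .coord (π ! k)) (vg .coord (π ! k)))

  lookup-E : ∀ x k → E x ! k ≡ (if s ! k then inv (W x k) else W x k)
  lookup-E x k = trans (lookup∘tabulate _ k) (cong (λ u → if s ! k then inv u else u)
    (trans (lookup∘tabulate _ k) (cong (conj (c ! k)) (lookup∘tabulate _ (π ! k)))))

  lookup-W : ∀ x k i → W x k ! i ≡ (g ! (π ! k) · c ! k) ! (x ! (π ! k) ! (a k ! i))
  lookup-W x k i = trans (lookup-conj (c ! k) (x ! (π ! k) · g ! (π ! k)) i) (trans (cong (c ! k !_) (lookup-· (x ! (π ! k)) (g ! (π ! k)) _))
    (sym (lookup-· (g ! (π ! k)) (c ! k) _)))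

  W⇒cell : ∀ x k {i j} → W x k ! i ≡ j → x ! (π ! k) ! (a k ! i) ≡ b k ! j
  W⇒cell x k {i} eq = sym (inv-intro (pgc k) (trans (sym (lookup-W x k i)) eq))

  cell⇒W : ∀ x k {i j} → x ! (π ! k) ! (a k ! i) ≡ b k ! j → W x k ! i ≡ j
  cell⇒W x k {i} eq = trans (lookup-W x k i) (inv-elim (pgc k) (sym eq))

  Vertex-E : ∀ {x} → Vertex x → Vertex (E x)
  Vertex-E {x} vx .coord k with s ! k | lookup-E x k
  ... | true  | eq = subst Alt (sym eq) (Alt-inv (Vertex-W vx k))
  ... | false | eq = subst Alt (sym eq) (Vertex-W vx k)

  E∋⇒∋Ψ : ∀ {x} → Vertex x → ∀ p → E x ∋ p → x ∋ Ψ p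
  E∋⇒∋Ψ {x} vx (k , i , j) eq with s ! k | lookup-E x k
  ... | true  | e = W⇒cell x k (inv-elim (Vertex-W vx k .isPerm) (trans (cong (_! i) (sym e)) eq))
  ... | false | e = W⇒cell x k (trans (cong (_! i) (sym e)) eq)

  ∋Ψ⇒E∋ : ∀ {x} → Vertex x → ∀ p → x ∋ Ψ p → E x ∋ p
  ∋Ψ⇒E∋ {x} vx (k , i , j) eq with s ! k | lookup-E x k
  ... | true  | e = trans (cong (_! i) e) (inv-intro (Vertex-W vx k .isPerm) (cell⇒W x k eq))
  ... | false | e = trans (cong (_! i) e) (cell⇒W x k eq)

  Ψ-surjective : ∀ p → ∃ λ p′ → Ψ p′ ≡ p
  Ψ-surjective (m , i , j) = at (inv π ! m) (lookup-inv-· pπ m)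
    where
    at : ∀ k → π ! k ≡ m → ∃ λ p′ → Ψ p′ ≡ (m , i , j)
    at k refl with s ! k in e
    ... | true  = (k , (g ! (π ! k) · c ! k) ! j , c ! k ! i) , trans (cong (λ t → if t then _ else _) e)
                    (cong₂ (λ i j → π ! k , i , j) (lookup-·-inv (pc k) i) (lookup-·-inv (pgc k) j))
    ... | false = (k , c ! k ! i , (g ! (π ! k) · c ! k) ! j) , trans (cong (λ t → if t then _ else _) e)
                    (cong₂ (λ i j → π ! k , i , j) (lookup-·-inv (pc k) i) (lookup-·-inv (pgc k) j))

  E-injective : ∀ {x y} → Vertex x → Vertex y → E x ≡ E y → x ≡ y
  E-injective {x} {y} vx vy eq = vec-ext λ m → vec-ext λ i → sym (same m i (Ψ-surjective (m , i , x ! m ! i)))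
    where
    same : ∀ m i → (∃ λ p → Ψ p ≡ (m , i , x ! m ! i)) → y ! m ! i ≡ x ! m ! i
    same m i (p , e) = subst (y ∋_) e (E∋⇒∋Ψ vy p (subst (_∋ p) eq (∋Ψ⇒E∋ vx p (subst (x ∋_) (sym e) refl))))

  Adj-E : ∀ {x y} → Vertex x → Vertex y → Adj x y → Adj (E x) (E y)
  Adj-E {x} {y} vx vy xy k i eq = common (Ψ p) (E∋⇒∋Ψ vx p eq) (E∋⇒∋Ψ vy p refl)
    where
    p : Cell n q
    p = k , i , E y ! k ! i
    common : ∀ p → x ∋ p → y ∋ p → ⊥
    common (m , i , j) ex ey = xy m i (trans ex (sym ey))

  Adj-E⁻ : ∀ {x y} → Vertex x → Vertex y → Adj (E x) (E y) → Adj x y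
  Adj-E⁻ {x} {y} vx vy xy m i eq with Ψ-surjective (m , i , y ! m ! i)
  ... | p , e = common p (∋Ψ⇒E∋ vx p (subst (x ∋_) (sym e) eq)) (∋Ψ⇒E∋ vy p (subst (y ∋_) (sym e) refl))
    where
    common : ∀ p → E x ∋ p → E y ∋ p → ⊥
    common (k , i , j) ex ey = xy k i (trans ex (sym ey))

  E-surjective : ∀ {y} → Vertex y → ∃ λ x → Vertex x × E x ≡ y
  E-surjective {y} vy = x , vx , vec-ext λ k → E-x k
    where
    y′ : Fin q → PermV n
    y′ k = if s ! k then inv (y ! k) else y ! k
    ay′ : ∀ k → Alt (y′ k)
    ay′ k with s ! k
    ... | true  = Alt-inv (vy .coord k)
    ... | false = vy .coord k
    preimage : Fin q → PermV n
    preimage k = conj (a k) (y′ k) · inv (g ! (π ! k))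
    x : V n q
    x = tabulate λ m → preimage (inv π ! m)
    vx : Vertex x
    vx = Vertex-tabulate λ m → Alt-· (Alt-conj (pa _) (ay′ _)) (Alt-inv (vg .coord _))
    lookup-x : ∀ k → x ! (π ! k) ≡ preimage k
    lookup-x k = trans (lookup∘tabulate _ (π ! k)) (cong preimage (lookup-·-inv pπ k))
    W-x : ∀ k → W x k ≡ y′ k
    W-x k = vec-ext λ i → begin
      W x k ! i                                          ≡⟨ lookup-W x k i ⟩
      (g ! (π ! k) · c ! k) ! (x ! (π ! k) ! (a k ! i))   ≡⟨ lookup-· (g ! (π ! k)) (c ! k) _ ⟩
      c ! k ! (g ! (π ! k) ! (x ! (π ! k) ! (a k ! i)))   ≡⟨ cong (λ u → c ! k ! (g ! (π ! k) ! (u ! (a k ! i)))) (lookup-x k) ⟩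
      c ! k ! (g ! (π ! k) ! (preimage k ! (a k ! i)))    ≡⟨ cong (λ t → c ! k ! (g ! (π ! k) ! t)) (lookup-· (conj (a k) (y′ k)) (inv (g ! (π ! k))) _) ⟩
      c ! k ! (g ! (π ! k) ! (inv (g ! (π ! k)) ! (conj (a k) (y′ k) ! (a k ! i))))
        ≡⟨ cong (c ! k !_) (lookup-inv-· (vg .coord (π ! k) .isPerm) _) ⟩
      c ! k ! (conj (a k) (y′ k) ! (a k ! i))             ≡⟨ cong (c ! k !_) (lookup-conj (a k) (y′ k) _) ⟩
      c ! k ! (a k ! (y′ k ! (inv (a k) ! (a k ! i))))    ≡⟨ lookup-inv-· (pc k) _ ⟩
      y′ k ! (inv (a k) ! (a k ! i))                      ≡⟨ cong (y′ k !_) (lookup-·-inv (pa k) i) ⟩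
      y′ k ! i                                           ∎
    E-x : ∀ k → E x ! k ≡ y ! k
    E-x k = trans (lookup-E x k) (trans (cong (λ u → if s ! k then inv u else u) (W-x k)) (undo (s ! k)))
      where
      undo : ∀ t → (if t then inv (if t then inv (y ! k) else y ! k) else (if t then inv (y ! k) else y ! k)) ≡ y ! k
      undo true  = inv-inv (vy .coord k .isPerm)
      undo false = refl

  ≗Elt⇒IsAut : (f : V n q → V n q) → f ≗ᵥ E → IsAut f
  ≗Elt⇒IsAut f f≗E =
    (λ x ix → subst IsVertex (sym (f≗E x ix)) (Vertex⇒IsVertex (Vertex-E (IsVertex⇒Vertex x ix)))) ,
    (λ x y ix iy eq → E-injective (IsVertex⇒Vertex x ix) (IsVertex⇒Vertex y iy) (trans (sym (f≗E x ix)) (trans eq (f≗E y iy)))) ,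
    (λ y iy → let x , vx , e = E-surjective (IsVertex⇒Vertex y iy)
              in x , Vertex⇒IsVertex vx , trans (f≗E x (Vertex⇒IsVertex vx)) e) ,
    λ x y ix iy →
      (λ xy → subst₂ Adj (sym (f≗E x ix)) (sym (f≗E y iy)) (Adj-E (IsVertex⇒Vertex x ix) (IsVertex⇒Vertex y iy) xy)) ,
      (λ fxy → Adj-E⁻ (IsVertex⇒Vertex x ix) (IsVertex⇒Vertex y iy) (subst₂ Adj (f≗E x ix) (f≗E y iy) fxy))

-- `Wact c π` is a group automorphism, so it carries right multiplication by `g` to right
-- multiplication by the image of `g`.
Rmul-normal : (g : V n q) (c : Vec (PermV n) q) (π : PermV q) → ValidParams g c π →
  Σ (V n q) λ g′ → IsVertex g′ × (∀ x → IsVertex x → Wact c π (Rmul g x) ≡ Rmul g′ (Wact c π x))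
Rmul-normal {n} {q} g c π (ig , pc , _) = Wact c π g ,
  Vertex⇒IsVertex (Vertex-tabulate λ k → Alt-conj {c = c ! k} (perm (pc k)) (IsVertex⇒Vertex g ig .coord (π ! k))) ,
  λ x _ → tabulate-cong λ k → trans (cong (conj (c ! k)) (lookup∘tabulate _ (π ! k)))
    (trans (conj-· {c ! k} (perm (pc k)) (x ! (π ! k)) (g ! (π ! k))) (sym (cong₂ _·_ (lookup∘tabulate _ k) (lookup∘tabulate _ k))))
  where
  conj-· : {d : PermV n} → Perm d → ∀ u w → conj d (u · w) ≡ conj d u · conj d w
  conj-· {d} pd u w = vec-ext λ i → begin
    conj d (u · w) ! i                                  ≡⟨ lookup-conj d (u · w) i ⟩
    d ! ((u · w) ! (inv d ! i))                         ≡⟨ cong (d !_) (lookup-· u w _) ⟩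
    d ! (w ! (u ! (inv d ! i)))                         ≡⟨ cong (λ t → d ! (w ! t)) (lookup-·-inv pd _) ⟨
    d ! (w ! (inv d ! (d ! (u ! (inv d ! i)))))         ≡⟨ lookup-conj d w _ ⟨
    conj d w ! (d ! (u ! (inv d ! i)))                  ≡⟨ cong (conj d w !_) (lookup-conj d u i) ⟨
    conj d w ! (conj d u ! i)                           ≡⟨ lookup-· (conj d u) (conj d w) i ⟨
    (conj d u · conj d w) ! i                           ∎

-- Decomposition of an arbitrary automorphism.

module Decompose {m q : ℕ} (n≥5 : 5 ≤ 2 ℕ.+ m) {f g : V (2 ℕ.+ m) q → V (2 ℕ.+ m) q} (auto : Auto f g) where
  open Auto auto

  private
    N : ℕ
    N = 2 ℕ.+ m

  ψ φ : Cell N q → Cell N q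
  ψ p = starImage n≥5 (Auto-sym auto) p .proj₁
  φ p = starImage n≥5 auto p .proj₁

  -- Chaining the inclusions for `f` and `g` puts the star of `φ (ψ p)` inside the star of `p`, and
  -- comparable stars are equal.
  φ∘ψ : ∀ p → φ (ψ p) ≡ p
  φ∘ψ p = ⊆⇒≡ n≥5 _ _ λ x vx x∋ → subst (_∋ p) (f∘g vx)
    (starImage n≥5 (Auto-sym auto) p .proj₂ (g x) (g-vertex vx) (starImage n≥5 auto (ψ p) .proj₂ x vx x∋))

  ∋ψ⇒f∋ : ∀ {x} → Vertex x → ∀ p → x ∋ ψ p → f x ∋ p
  ∋ψ⇒f∋ vx p = starImage n≥5 (Auto-sym auto) p .proj₂ _ vx

  f∋⇒∋ψ : ∀ {x} → Vertex x → ∀ p → f x ∋ p → x ∋ ψ p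
  f∋⇒∋ψ {x} vx p fx∋ = subst (_∋ ψ p) (g∘f vx)
    (starImage n≥5 auto (ψ p) .proj₂ (f x) (f-vertex vx) (subst (f x ∋_) (sym (φ∘ψ p)) fx∋))

  ψ-injective : ∀ {p p′} → ψ p ≡ ψ p′ → p ≡ p′
  ψ-injective {p} {p′} eq = trans (sym (φ∘ψ p)) (trans (cong φ eq) (φ∘ψ p′))

  ψ-conflict : ∀ {p p′} → Conflict p p′ → Conflict (ψ p) (ψ p′)
  ψ-conflict {p} {p′} c x vx x∋ x∋′ = c (f x) (f-vertex vx) (∋ψ⇒f∋ vx p x∋) (∋ψ⇒f∋ vx p′ x∋′)

  module Coordinate (k : Fin q) where

    K : Fin N → Fin N → Fin q
    K i j = ψ (k , i , j) .proj₁

    F G : Fin N → Fin N → Fin N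
    F i j = ψ (k , i , j) .proj₂ .proj₁
    G i j = ψ (k , i , j) .proj₂ .proj₂

    row-line : ∀ i j j′ → K i j ≡ K i j′ × (F i j ≡ F i j′ ⊎ G i j ≡ G i j′)
    row-line i j j′ with j ≟ j′
    ... | yes refl = refl , inj₁ refl
    ... | no j≢j′  = conflict⇒line n≥5 (ψ-conflict λ x vx e e′ → j≢j′ (trans (sym e) e′))

    col-line : ∀ i i′ j → K i j ≡ K i′ j × (F i j ≡ F i′ j ⊎ G i j ≡ G i′ j)
    col-line i i′ j with i ≟ i′
    ... | yes refl = refl , inj₁ refl
    ... | no i≢i′  = conflict⇒line n≥5 (ψ-conflict λ x vx e e′ → i≢i′ (vx .coord k .isPerm .injective i i′ (trans e (sym e′))))

    κ : Fin q
    κ = K 0F 0F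

    K-const : ∀ i j → K i j ≡ κ
    K-const i j = trans (row-line i j 0F .proj₁) (col-line i 0F 0F .proj₁)

    FG-injective : ∀ {i j i′ j′} → F i j ≡ F i′ j′ → G i j ≡ G i′ j′ → i ≡ i′ × j ≡ j′
    FG-injective {i} {j} {i′} {j′} eF eG with ψ-injective {k , i , j} {k , i′ , j′}
      (cong₂ _,_ (trans (K-const i j) (sym (K-const i′ j′))) (cong₂ _,_ eF eG))
    ... | refl = refl , refl

    opaque
      -- The images of (0, 0) and (0, 1) decide the orientation. If their F-values differ they share
      -- a G-value, and the same argument with F and G exchanged gives the transposed form, which
      -- corresponds to inverting the coordinate.
      shape : ∃ λ s → ∃₂ λ (α β : Fin N → Fin N) →
        ∀ i j → ψ (k , i , j) ≡ (if s then (κ , α j , β i) else (κ , α i , β j))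
      shape with F 0F 0F ≟ F 0F 1F
      ... | yes e = false , (λ i → F i 0F) , (λ j → G 0F j) , λ i j →
        let eF , eG = rook-rows F G FG-injective (λ i j j′ → row-line i j j′ .proj₂) (λ i i′ j → col-line i i′ j .proj₂) e i j
        in cong₂ _,_ (K-const i j) (cong₂ _,_ eF eG)
      ... | no ne = true , (λ j → F 0F j) , (λ i → G i 0F) , λ i j →
        let eG , eF = rook-rows G F (λ eG eF → FG-injective eF eG) (λ i j j′ → swap⊎ (row-line i j j′ .proj₂))
                        (λ i i′ j → swap⊎ (col-line i i′ j .proj₂)) G₀₀≡G₀₁ i j
        in cong₂ _,_ (K-const i j) (cong₂ _,_ eF eG)
        where
        G₀₀≡G₀₁ : G 0F 0F ≡ G 0F 1F
        G₀₀≡G₀₁ = [ ⊥-elim ∘ ne , id ]′ (row-line 0F 0F 1F .proj₂)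

    s : Bool
    s = shape .proj₁

    α₀ β₀ : Fin N → Fin N
    α₀ = shape .proj₂ .proj₁
    β₀ = shape .proj₂ .proj₂ .proj₁

    α β : PermV N
    α = tabulate α₀
    β = tabulate β₀

    ψ-shape : ∀ i j → ψ (k , i , j) ≡ (if s then (κ , α ! j , β ! i) else (κ , α ! i , β ! j))
    ψ-shape i j = trans (shape .proj₂ .proj₂ .proj₂ i j) (cells s)
      where
      cells : ∀ t → (if t then (κ , α₀ j , β₀ i) else (κ , α₀ i , β₀ j)) ≡
                  (if t then (κ , α ! j , β ! i) else (κ , α ! i , β ! j))
      cells true  = cong₂ (λ a b → κ , a , b) (sym (lookup∘tabulate α₀ j)) (sym (lookup∘tabulate β₀ i))
      cells false = cong₂ (λ a b → κ , a , b) (sym (lookup∘tabulate α₀ i)) (sym (lookup∘tabulate β₀ j))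

    pα : Perm α
    pα .injective i i′ eq with s | ψ-shape
    ... | true  | sh with ψ-injective {k , 0F , i} {k , 0F , i′} (trans (sh 0F i) (trans (cong (λ a → κ , a , β ! 0F) eq) (sym (sh 0F i′))))
    ...   | refl = refl
    pα .injective i i′ eq | false | sh
      with ψ-injective {k , i , 0F} {k , i′ , 0F} (trans (sh i 0F) (trans (cong (λ a → κ , a , β ! 0F) eq) (sym (sh i′ 0F))))
    ...   | refl = refl

    pβ : Perm β
    pβ .injective i i′ eq with s | ψ-shape
    ... | false | sh with ψ-injective {k , 0F , i} {k , 0F , i′} (trans (sh 0F i) (trans (cong (λ b → κ , α ! 0F , b) eq) (sym (sh 0F i′))))
    ...   | refl = refl
    pβ .injective i i′ eq | true | sh
      with ψ-injective {k , i , 0F} {k , i′ , 0F} (trans (sh i 0F) (trans (cong (λ b → κ , α ! 0F , b) eq) (sym (sh i′ 0F))))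
    ...   | refl = refl

    hits : ∀ a b → ∃₂ λ i j → ψ (k , i , j) ≡ (κ , a , b)
    hits a b with s | ψ-shape
    ... | true  | sh = inv β ! b , inv α ! a , trans (sh _ _) (cong₂ (λ a b → κ , a , b) (lookup-inv-· pα a) (lookup-inv-· pβ b))
    ... | false | sh = inv α ! a , inv β ! b , trans (sh _ _) (cong₂ (λ a b → κ , a , b) (lookup-inv-· pα a) (lookup-inv-· pβ b))

    -- Apply f to the identity vertex.
    sgn-α≡sgn-β : sgn α ≡ sgn β
    sgn-α≡sgn-β = compare s ψ-shape
      where
      e : V N q
      e = tabulate λ _ → ι
      ve : Vertex e
      ve = Vertex-tabulate λ _ → Alt-ι
      u : PermV N
      u = f e ! k
      au : Alt u
      au = f-vertex ve .coord k
      -- The identity contains only diagonal cells, and it contains the image under `ψ` of every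
      -- cell of `u`. Hence `α` and `β` differ by the even permutation `u`.
      diagonal : ∀ i {a b} → ψ (k , i , u ! i) ≡ (κ , a , b) → a ≡ b
      diagonal i {a} {b} eq = begin
        a              ≡⟨ lookup-ι a ⟨
        ι ! a          ≡⟨ cong (_! a) (lookup∘tabulate {n = q} (λ _ → ι) κ) ⟨
        e ! κ ! a      ≡⟨ subst (e ∋_) eq (f∋⇒∋ψ ve (k , i , u ! i) refl) ⟩
        b              ∎
      absorb : ∀ {σ τ} → Perm σ → (∀ i → σ ! (u ! i) ≡ τ ! i) → sgn τ ≡ sgn σ
      absorb {σ} {τ} pσ h = begin
        sgn τ            ≡⟨ cong sgn (vec-ext λ i → trans (lookup-· u σ i) (h i)) ⟨
        sgn (u · σ)      ≡⟨ sgn-· (au .isPerm) pσ ⟩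
        sgn u ⊕ sgn σ    ≡⟨ cong (_⊕ sgn σ) (au .isEven) ⟩
        sgn σ            ∎
      compare : ∀ t → (∀ i j → ψ (k , i , j) ≡ (if t then (κ , α ! j , β ! i) else (κ , α ! i , β ! j))) → sgn α ≡ sgn β
      compare true  sh = sym (absorb pα λ i → diagonal i (sh i (u ! i)))
      compare false sh = absorb pβ λ i → sym (diagonal i (sh i (u ! i)))

  open Coordinate using (κ; s; α; β; pα; pβ; ψ-shape; hits; sgn-α≡sgn-β)

  π : PermV q
  π = tabulate κ

  -- The cells of coordinate `k` already fill all of coordinate `κ k`, so a second coordinate sent
  -- there would contradict injectivity of `ψ`.
  pπ : Perm π
  pπ .injective k k′ eq with hits k (α k′ ! 0F) (β k′ ! 0F)
  ... | i , j , e with ψ-injective {k , i , j} {k′ , 0F , 0F} (trans e (trans (cong (λ l → l , α k′ ! 0F , β k′ ! 0F) κk≡κk′) (sym (corner (s k′) (ψ-shape k′ 0F 0F)))))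
    where
    κk≡κk′ : κ k ≡ κ k′
    κk≡κk′ = trans (sym (lookup∘tabulate κ k)) (trans eq (lookup∘tabulate κ k′))
    corner : ∀ t → ψ (k′ , 0F , 0F) ≡ (if t then (κ k′ , α k′ ! 0F , β k′ ! 0F) else (κ k′ , α k′ ! 0F , β k′ ! 0F)) →
      ψ (k′ , 0F , 0F) ≡ (κ k′ , α k′ ! 0F , β k′ ! 0F)
    corner true  e = e
    corner false e = e
  ...   | refl = refl

  -- The translation part is forced: with c = α⁻¹, the equation (g c)⁻¹ = β has the solution g = β⁻¹
  -- α. It is even because `α` and `β` have the same sign. In `h` it is placed at index `π ! k`.
  γ : Fin q → PermV N
  γ k = inv (β k) · α k

  Alt-γ : ∀ k → Alt (γ k)
  Alt-γ k = alt (Perm-· (Perm-inv (pβ k)) (pα k))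
    (trans (sgn-· (Perm-inv (pβ k)) (pα k)) (trans (cong₂ _⊕_ (sgn-inv (pβ k)) (sgn-α≡sgn-β k)) (⊕-self (sgn (β k)))))

  h : V N q
  h = tabulate λ l → γ (inv π ! l)

  vh : Vertex h
  vh = Vertex-tabulate λ l → Alt-γ (inv π ! l)

  c : Vec (PermV N) q
  c = tabulate λ k → inv (α k)

  pc : ∀ k → Perm (c ! k)
  pc k = subst Perm (sym (lookup∘tabulate _ k)) (Perm-inv (pα k))

  σ : Vec Bool q
  σ = tabulate s

  open Params {g = h} {c} {π} σ vh pc pπ using (Ψ; E; ∋Ψ⇒E∋; a; b; pgc)

  a≡α : ∀ k i → a k ! i ≡ α k ! i
  a≡α k i = trans (cong (λ u → inv u ! i) (lookup∘tabulate _ k)) (cong (_! i) (inv-inv (pα k)))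

  b≡β : ∀ k j → b k ! j ≡ β k ! j
  b≡β k j = inv-intro (pgc k) (begin
    (h ! (π ! k) · c ! k) ! (β k ! j)             ≡⟨ lookup-· (h ! (π ! k)) (c ! k) _ ⟩
    c ! k ! (h ! (π ! k) ! (β k ! j))             ≡⟨ cong₂ (λ u w → u ! (w ! (β k ! j))) (lookup∘tabulate _ k)
                                                       (trans (lookup∘tabulate _ (π ! k)) (cong γ (lookup-·-inv pπ k))) ⟩
    inv (α k) ! (γ k ! (β k ! j))                 ≡⟨ cong (inv (α k) !_) (lookup-· (inv (β k)) (α k) (β k ! j)) ⟩
    inv (α k) ! (α k ! (inv (β k) ! (β k ! j)))   ≡⟨ lookup-·-inv (pα k) _ ⟩
    inv (β k) ! (β k ! j)                         ≡⟨ lookup-·-inv (pβ k) j ⟩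
    j                                             ∎)

  ψ≡Ψ : ∀ p → ψ p ≡ Ψ p
  ψ≡Ψ (k , i , j) = trans (ψ-shape k i j) (trans (cells (s k))
    (cong (λ t → if t then (π ! k , a k ! j , b k ! i) else (π ! k , a k ! i , b k ! j)) (sym (lookup∘tabulate s k))))
    where
    cell : ∀ i j → (κ k , α k ! i , β k ! j) ≡ (π ! k , a k ! i , b k ! j)
    cell i j = cong₂ _,_ (sym (lookup∘tabulate κ k)) (cong₂ _,_ (sym (a≡α k i)) (sym (b≡β k j)))
    cells : ∀ t → (if t then (κ k , α k ! j , β k ! i) else (κ k , α k ! i , β k ! j)) ≡
                  (if t then (π ! k , a k ! j , b k ! i) else (π ! k , a k ! i , b k ! j))
    cells true  = cell j i
    cells false = cell i j

  f≗E : ∀ {x} → Vertex x → f x ≡ E x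
  f≗E {x} vx = vec-ext λ k → vec-ext λ i → sym (∋Ψ⇒E∋ vx (k , i , f x ! k ! i)
    (subst (x ∋_) (ψ≡Ψ (k , i , f x ! k ! i)) (f∋⇒∋ψ vx (k , i , f x ! k ! i) refl)))

IsAut⇒Elt : 5 ≤ n → (f : V n q → V n q) → IsAut f → Σ (V n q) λ g → Σ (Vec (PermV n) q) λ c → Σ (PermV q) λ π →
  Σ (Vec Bool q) λ s → ValidParams g c π × (f ≗ᵥ Elt g c π s)
IsAut⇒Elt n≥5@(s≤s (s≤s _)) f fAut =
  h , c , π , σ , (Vertex⇒IsVertex vh , (λ k → pc k .injective) , pπ .injective) , λ x ix → f≗E (IsVertex⇒Vertex x ix)
  where open Decompose n≥5 (IsAut⇒Auto f fAut .proj₂)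

-- Uniqueness of the factorisation.

≡-cell : ∀ {k k′ : Fin q} {i i′ j j′ : Fin n} → (k , i , j) ≡ (k′ , i′ , j′) → k ≡ k′ × i ≡ i′ × j ≡ j′
≡-cell refl = refl , refl , refl

two-points : 5 ≤ n → ∃₂ λ (i j : Fin n) → i ≢ j
two-points (s≤s (s≤s _)) = 0F , 1F , λ ()

module _ (n≥5 : 5 ≤ n) (s s′ : Vec Bool q)
  {g g′ : V n q} (vg : Vertex g) (vg′ : Vertex g′)
  {c c′ : Vec (PermV n) q} (pc : ∀ k → Perm (c ! k)) (pc′ : ∀ k → Perm (c′ ! k))
  {π π′ : PermV q} (pπ : Perm π) (pπ′ : Perm π′) (E≗E′ : Elt g c π s ≗ᵥ Elt g′ c′ π′ s′) where

  private
    module P  = Params {g = g} {c} {π} s vg pc pπ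
    module P′ = Params {g = g′} {c′} {π′} s′ vg′ pc′ pπ′

    -- Equal maps pull each star back to the same set, so the cells agree; `a`, `b`, the coordinate
    -- and the orientation can then be read off.
    Ψ≡Ψ′ : ∀ p → P.Ψ p ≡ P′.Ψ p
    Ψ≡Ψ′ p = ⊆⇒≡ n≥5 _ _ λ x vx x∋ →
      P′.E∋⇒∋Ψ vx p (subst (_∋ p) (E≗E′ x (Vertex⇒IsVertex vx)) (P.∋Ψ⇒E∋ vx p x∋))

    coordinate : ∀ k → s ! k ≡ s′ ! k × π ! k ≡ π′ ! k × (∀ i → P.a k ! i ≡ P′.a k ! i) × (∀ j → P.b k ! j ≡ P′.b k ! j)
    coordinate k with s ! k | s′ ! k | (λ i j → Ψ≡Ψ′ (k , i , j))
    ... | true  | true  | eq = refl , ≡-cell (eq pt pt) .proj₁ , (λ i → ≡-cell (eq pt i) .proj₂ .proj₁) , λ j → ≡-cell (eq j pt) .proj₂ .proj₂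
      where pt = two-points n≥5 .proj₁
    ... | false | false | eq = refl , ≡-cell (eq pt pt) .proj₁ , (λ i → ≡-cell (eq i pt) .proj₂ .proj₁) , λ j → ≡-cell (eq pt j) .proj₂ .proj₂
      where pt = two-points n≥5 .proj₁
    -- With opposite orientations the row of the image would depend only on the column for one rule
    -- and only on the row for the other; varying the column makes `a` take one value at two points.
    ... | true  | false | eq = let i , j , i≢j = two-points n≥5 in
      ⊥-elim (i≢j (P.pa k .injective i j (trans (≡-cell (eq i i) .proj₂ .proj₁) (sym (≡-cell (eq i j) .proj₂ .proj₁)))))
    ... | false | true  | eq = let i , j , i≢j = two-points n≥5 in
      ⊥-elim (i≢j (P.pa k .injective i j (trans (≡-cell (eq i i) .proj₂ .proj₁) (sym (≡-cell (eq j i) .proj₂ .proj₁)))))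

    c≡ : ∀ k → c ! k ≡ c′ ! k
    c≡ k = trans (sym (inv-inv (pc k))) (trans (cong inv (vec-ext {xs = P.a k} {P′.a k} (coordinate k .proj₂ .proj₂ .proj₁))) (inv-inv (pc′ k)))

    gc≡ : ∀ k → g ! (π ! k) · c ! k ≡ g′ ! (π′ ! k) · c′ ! k
    gc≡ k = trans (sym (inv-inv (P.pgc k))) (trans (cong inv (vec-ext {xs = P.b k} {P′.b k} (coordinate k .proj₂ .proj₂ .proj₂))) (inv-inv (P′.pgc k)))

    π≡ : π ≡ π′
    π≡ = vec-ext λ k → coordinate k .proj₂ .proj₁

    g≡-at : ∀ k → g ! (π ! k) ≡ g′ ! (π ! k)
    g≡-at k = vec-ext λ i → pc k .injective _ _ (begin
      c ! k ! (g ! (π ! k) ! i)               ≡⟨ lookup-· (g ! (π ! k)) (c ! k) i ⟨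
      (g ! (π ! k) · c ! k) ! i               ≡⟨ cong (_! i) (gc≡ k) ⟩
      (g′ ! (π′ ! k) · c′ ! k) ! i            ≡⟨ lookup-· (g′ ! (π′ ! k)) (c′ ! k) i ⟩
      c′ ! k ! (g′ ! (π′ ! k) ! i)            ≡⟨ cong₂ (λ u l → u ! (g′ ! l ! i)) (c≡ k) (coordinate k .proj₂ .proj₁) ⟨
      c ! k ! (g′ ! (π ! k) ! i)              ∎)

  Elt-unique : (g ≡ g′) × (c ≡ c′) × (π ≡ π′) × (s ≡ s′)
  Elt-unique = vec-ext (λ l → subst (λ l → g ! l ≡ g′ ! l) (lookup-inv-· pπ l) (g≡-at (inv π ! l))) ,
    vec-ext c≡ , π≡ , vec-ext λ k → coordinate k .proj₁

theorem1p3 : (n q : ℕ) → 5 ≤ n → 1 ≤ q →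
    -- Aut(AΓ_n^q) = R(A_n^q) · (Inn(S_n) ≀ S_q) · Z_2^q as permutation groups of A_n^q
    ((f : V n q → V n q) →
      (IsAut f → Σ (V n q) λ g → Σ (Vec (PermV n) q) λ c → Σ (PermV q) λ π → Σ (Vec Bool q) λ ε →
         ValidParams g c π × (f ≗ᵥ Elt g c π ε))
      × ((g : V n q) (c : Vec (PermV n) q) (π : PermV q) (ε : Vec Bool q) →
           ValidParams g c π → f ≗ᵥ Elt g c π ε → IsAut f))
    -- the factorisation is unique (trivial intersections, Inn(S_n) ≅ S_n acts faithfully,
    -- Z_2^q = ⟨φ_1⟩ × ⋯ × ⟨φ_q⟩ has order 2^q)
    × ((g g' : V n q) (c c' : Vec (PermV n) q) (π π' : PermV q) (ε ε' : Vec Bool q) →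
         ValidParams g c π → ValidParams g' c' π' →
         Elt g c π ε ≗ᵥ Elt g' c' π' ε' →
         (g ≡ g') × (c ≡ c') × (π ≡ π') × (ε ≡ ε'))
    -- R(A_n^q) is normal in R(A_n^q) · (Inn(S_n) ≀ S_q)
    × ((g : V n q) (c : Vec (PermV n) q) (π : PermV q) → ValidParams g c π →
         Σ (V n q) λ g' → IsVertex g' × (∀ x → IsVertex x → Wact c π (Rmul g x) ≡ Rmul g' (Wact c π x)))
theorem1p3 n q n≥5 _ =
  (λ f → IsAut⇒Elt n≥5 f ,
     λ g c π s (ig , pc , pπ) → Params.≗Elt⇒IsAut {c = c} {π} s (IsVertex⇒Vertex g ig) (perm ∘ pc) (perm pπ) f) ,
  (λ g g′ c c′ π π′ s s′ (ig , pc , pπ) (ig′ , pc′ , pπ′) →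
     Elt-unique n≥5 s s′ (IsVertex⇒Vertex g ig) (IsVertex⇒Vertex g′ ig′) (perm ∘ pc) (perm ∘ pc′) (perm pπ) (perm pπ′)) ,
  Rmul-normal
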